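{- For every integer $k\ge 1$ and every $\epsilon>0$ we have $F_k(x)=x\,P_k^F(\log x)+\Delta_k^F(x)$ for $x\ge 1$, where $$P_k^F(t)=\sum_{j=0}^{k-1}b_{k,j}\,t^j,\qquad b_{k,j}=\sum_{i=j+1}^{k}(-1)^{k-i}\binom{k}{i}a_{i,j},$$ $$\Delta_k^F(x)=O\!\left(x^{\beta_k+\epsilon}\right)\quad (x\to\infty),\qquad \beta_k=\max_{1\le j\le k}\alpha_j ,$$ with $\alpha_j=\frac{j-1}{j}$, the implied constant depending only on $k$ and $\epsilon$. Here the $a_{i,j}$ are the coefficients in the divisor problem as defined in the context.
   Context: For integers $n,k\ge1$: $d_k(n)$ is the number of $k$-tuples of positive integers with product $n$, and $f_k(n)$ is the number of $k$-tuples of integers, each $\ge 2$, with product $n$. For real $x\ge1$: $D_k(x)=\sum_{n\le x}d_k(n)$ and $F_k(x)=\sum_{n\le x}f_k(n)$. With $\alpha_k=\frac{k-1}{k}$, the following is known: for each $k\ge 1$ there exist (necessarily unique) real numbers $a_{k,0},\dots,a_{k,k-1}$ such that for every $\epsilon>0$, $D_k(x)=x\sum_{j=0}^{k-1}a_{k,j}(\log x)^j+O(x^{\alpha_k+\epsilon})$ as $x\to\infty$. These are the coefficients $a_{k,j}$ in the claim (e.g. $a_{1,0}=1$). -}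

module Defs where

open import Algebra.Definitions.RawSemiring using () renaming (_^_ to pow)
open import Data.Integer.Base as ℤ using (ℤ; -1ℤ)
import Data.Integer.Properties as ℤ
open import Data.List.Base
  using (List; []; _∷_; map; foldr; filter; length; upTo; applyUpTo; cartesianProductWith)
open import Data.Nat.Base as ℕ using (ℕ; zero; suc; _∸_; _!)
open import Data.Nat.Combinatorics using (_C_)
open import Data.Nat.ListAction using (sum)
import Data.Nat.Properties as ℕ
open import Data.Product using (Σ; Σ-syntax; _×_; _,_; proj₁; proj₂)
open import Data.Rational.Base as ℚ using (ℚ; 0ℚ; 1ℚ)
import Data.Rational.Properties as ℚ
import Data.Rational.Unnormalised.Base as ℚᵘ
import Data.Rational.Unnormalised.Properties as ℚᵘ
open import Data.Rational.Solver using (module +-*-Solver)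
open import Data.Sum using (inj₁; inj₂)
open import Data.Vec.Base using (Vec; []; _∷_; foldr′)
open import Relation.Binary.PropositionalEquality
  using (_≡_; refl; sym; trans; cong; cong₂; subst; subst₂)

infixr 8 _^ℚ_

_^ℚ_ : ℚ → ℕ → ℚ
_^ℚ_ = pow ℚ.+-*-rawSemiring

fromℕℚ : ℕ → ℚ
fromℕℚ n = ℤ.+ n ℚ./ 1

Eventually : (ℕ → Set) → Set
Eventually P = Σ[ N ∈ ℕ ] (∀ n → N ℕ.≤ n → P n)

record IsCauchy (s : ℕ → ℚ) : Set where
  constructor mkCauchy
  field
    near : ∀ e → 0ℚ ℚ.< e →
      Σ[ N ∈ ℕ ] (∀ m n → N ℕ.≤ m → N ℕ.≤ n → ℚ.∣ s m ℚ.- s n ∣ ℚ.≤ e)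

open IsCauchy public

-- psum t n = t 0 + … + t (n ∸ 1)
psum : (ℕ → ℚ) → ℕ → ℚ
psum t zero    = 0ℚ
psum t (suc n) = psum t n ℚ.+ t n

-- These lemmas only serve to show that the operations on real numbers below
-- preserve the Cauchy property; expCoeff, logCoeff and logArg are the
-- ingredients of the series for exp and log.
module CauchyProperties where

  open import Data.Rational.Base hiding (_≃_)
  open import Data.Rational.Properties
  open +-*-Solver
  open ≤-Reasoning

  toℚᵘ-fromℕ : ∀ n → toℚᵘ (fromℕℚ n) ℚᵘ.≃ ℚᵘ.mkℚᵘ (ℤ.+ n) 0
  toℚᵘ-fromℕ n = toℚᵘ-fromℚᵘ (ℚᵘ.mkℚᵘ (ℤ.+ n) 0)

  fromℕℚ-mono : ∀ {m n} → m ℕ.≤ n → fromℕℚ m ≤ fromℕℚ n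
  fromℕℚ-mono {m} {n} m≤n = toℚᵘ-cancel-≤ (ℚᵘ.≤-respˡ-≃ (ℚᵘ.≃-sym (toℚᵘ-fromℕ m))
    (ℚᵘ.≤-respʳ-≃ (ℚᵘ.≃-sym (toℚᵘ-fromℕ n))
      (ℚᵘ.*≤* (ℤ.*-monoʳ-≤-nonNeg (ℤ.+ 1) (ℤ.+≤+ m≤n)))))

  fromℕℚ-suc : ∀ n → fromℕℚ (suc n) ≡ 1ℚ + fromℕℚ n
  fromℕℚ-suc n = toℚᵘ-injective (ℚᵘ.≃-trans (toℚᵘ-fromℕ (suc n)) (ℚᵘ.≃-sym
    (ℚᵘ.≃-trans (toℚᵘ-homo-+ 1ℚ (fromℕℚ n))
      (ℚᵘ.≃-trans (ℚᵘ.+-congʳ (toℚᵘ 1ℚ) (toℚᵘ-fromℕ n))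
        (ℚᵘ.*≡* (cong (ℤ._* ℤ.+ 1) (cong (λ z → ℤ.+ 1 ℤ.+ z) (ℤ.*-identityʳ (ℤ.+ n)))))))))

  0≤fromℕℚ : ∀ n → 0ℚ ≤ fromℕℚ n
  0≤fromℕℚ n = fromℕℚ-mono {0} {n} ℕ.z≤n

  0<fromℕℚ-suc : ∀ n → 0ℚ < fromℕℚ (suc n)
  0<fromℕℚ-suc n = <-≤-trans (positive⁻¹ 1ℚ) (fromℕℚ-mono {1} {suc n} (ℕ.s≤s ℕ.z≤n))

  fromℕℚ-+ : ∀ m n → fromℕℚ (m ℕ.+ n) ≡ fromℕℚ m + fromℕℚ n
  fromℕℚ-+ zero    n = sym (+-identityˡ _)
  fromℕℚ-+ (suc m) n = trans (fromℕℚ-suc (m ℕ.+ n))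
    (trans (cong (λ z → 1ℚ + z) (fromℕℚ-+ m n))
      (trans (sym (+-assoc 1ℚ (fromℕℚ m) (fromℕℚ n)))
        (cong (_+ fromℕℚ n) (sym (fromℕℚ-suc m)))))

  fromℕℚ-* : ∀ m n → fromℕℚ (m ℕ.* n) ≡ fromℕℚ m * fromℕℚ n
  fromℕℚ-* zero    n = sym (*-zeroˡ (fromℕℚ n))
  fromℕℚ-* (suc m) n = trans (fromℕℚ-+ n (m ℕ.* n))
    (trans (cong (λ z → fromℕℚ n + z) (fromℕℚ-* m n))
      (trans (solve 2 (λ a b → b :+ a :* b := (con 1ℚ :+ a) :* b) refl (fromℕℚ m) (fromℕℚ n))
        (cong (_* fromℕℚ n) (sym (fromℕℚ-suc m)))))

  archimedean : ∀ q → Σ[ n ∈ ℕ ] q ≤ fromℕℚ n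
  archimedean q@(mkℚ (ℤ.+ n) d _) = n , toℚᵘ-cancel-≤ (ℚᵘ.≤-respʳ-≃ (ℚᵘ.≃-sym (toℚᵘ-fromℕ n))
    (ℚᵘ.*≤* (ℤ.*-monoˡ-≤-nonNeg (ℤ.+ n) (ℤ.+≤+ (ℕ.s≤s ℕ.z≤n)))))
  archimedean q@(mkℚ ℤ.-[1+ n ] d _) = 0 , *≤* ℤ.-≤+

  fromℕℚ-recip : ∀ n .{{_ : ℕ.NonZero n}} → fromℕℚ n * (ℤ.+ 1 / n) ≡ 1ℚ
  fromℕℚ-recip n@(suc k) = toℚᵘ-injective (ℚᵘ.≃-trans (toℚᵘ-homo-* (fromℕℚ n) (ℤ.+ 1 / n))
    (ℚᵘ.≃-trans (ℚᵘ.*-cong (toℚᵘ-fromℕ n) (toℚᵘ-fromℚᵘ (ℚᵘ.mkℚᵘ (ℤ.+ 1) k)))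
      (ℚᵘ.*≡* (trans (ℤ.*-identityʳ _) (trans (ℤ.*-identityʳ (ℤ.+ n))
        (sym (trans (ℤ.*-identityˡ _) (ℤ.*-identityˡ (ℤ.+ n)))))))))

  0≤recip : ∀ n .{{_ : ℕ.NonZero n}} → 0ℚ ≤ ℤ.+ 1 / n
  0≤recip n = nonNegative⁻¹ (ℤ.+ 1 / n) {{normalize-nonNeg 1 n}}

  *-mono-≤₀ : ∀ {p q r s} → 0ℚ ≤ r → 0ℚ ≤ q → p ≤ q → r ≤ s → p * r ≤ q * s
  *-mono-≤₀ {p} {q} {r} {s} 0≤r 0≤q p≤q r≤s = ≤-trans
    (*-monoʳ-≤-nonNeg r {{nonNegative 0≤r}} p≤q) (*-monoˡ-≤-nonNeg q {{nonNegative 0≤q}} r≤s)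

  *-monoˡ₀ : ∀ {p r s} → 0ℚ ≤ p → r ≤ s → p * r ≤ p * s
  *-monoˡ₀ {p} 0≤p = *-monoˡ-≤-nonNeg p {{nonNegative 0≤p}}

  *-monoʳ₀ : ∀ {p r s} → 0ℚ ≤ p → r ≤ s → r * p ≤ s * p
  *-monoʳ₀ {p} 0≤p = *-monoʳ-≤-nonNeg p {{nonNegative 0≤p}}

  0≤* : ∀ {p q} → 0ℚ ≤ p → 0ℚ ≤ q → 0ℚ ≤ p * q
  0≤* {p} {q} 0≤p 0≤q = subst (_≤ p * q) (*-zeroʳ p) (*-monoˡ₀ 0≤p 0≤q)

  0≤+ : ∀ {p q} → 0ℚ ≤ p → 0ℚ ≤ q → 0ℚ ≤ p + q
  0≤+ = +-mono-≤ {0ℚ} {_} {0ℚ}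

  0≤^ : ∀ {p} → 0ℚ ≤ p → ∀ n → 0ℚ ≤ p ^ℚ n
  0≤^ 0≤p zero    = nonNegative⁻¹ 1ℚ
  0≤^ 0≤p (suc n) = 0≤* 0≤p (0≤^ 0≤p n)

  p≤q+r⇒p-q≤r : ∀ {p q r} → p ≤ q + r → p - q ≤ r
  p≤q+r⇒p-q≤r {p} {q} {r} h = subst (p - q ≤_)
    (solve 2 (λ a b → a :+ b :- a := b) refl q r) (+-monoˡ-≤ (- q) h)

  ∣∣≤ : ∀ {p e} → p ≤ e → - p ≤ e → ∣ p ∣ ≤ e
  ∣∣≤ {p} {e} h₁ h₂ with ∣p∣≡p∨∣p∣≡-p p
  ... | inj₁ eq = subst (_≤ e) (sym eq) h₁
  ... | inj₂ eq = subst (_≤ e) (sym eq) h₂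

  p≤∣p∣ : ∀ p → p ≤ ∣ p ∣
  p≤∣p∣ p with ≤-total 0ℚ p
  ... | inj₁ 0≤p = ≤-reflexive (sym (0≤p⇒∣p∣≡p 0≤p))
  ... | inj₂ p≤0 = ≤-trans p≤0 (0≤∣p∣ p)

  p≤q⇒0≤q-p : ∀ {p q} → p ≤ q → 0ℚ ≤ q - p
  p≤q⇒0≤q-p {p} {q} p≤q = subst (_≤ q - p) (+-inverseʳ p) (+-monoˡ-≤ (- p) p≤q)

  ∣-∣-comm : ∀ p q → ∣ p - q ∣ ≡ ∣ q - p ∣
  ∣-∣-comm p q = trans (sym (∣-p∣≡∣p∣ (p - q)))
    (cong ∣_∣ (solve 2 (λ a b → :- (a :- b) := b :- a) refl p q))

  triangle : ∀ p q r → ∣ p - r ∣ ≤ ∣ p - q ∣ + ∣ q - r ∣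
  triangle p q r = subst (λ z → ∣ z ∣ ≤ ∣ p - q ∣ + ∣ q - r ∣)
    (solve 3 (λ a b c → (a :- b) :+ (b :- c) := a :- c) refl p q r)
    (∣p+q∣≤∣p∣+∣q∣ (p - q) (q - r))

  halve : ∀ e → e * ½ + e * ½ ≡ e
  halve e = trans (sym (*-distribˡ-+ e ½ ½)) (*-identityʳ e)

  0<half : ∀ {e} → 0ℚ < e → 0ℚ < e * ½
  0<half = *-monoˡ-<-pos ½

  shrink : ∀ {b e} → 0ℚ < b → 0ℚ < e → Σ[ e′ ∈ ℚ ] (0ℚ < e′ × b * e′ ≡ e)
  shrink {b} {e} 0<b 0<e = 1/ b * e , 0<e′ , eq
    where
    instance
      pos-b = positive 0<b
      nz-b  = pos⇒nonZero b
    0<e′ : 0ℚ < 1/ b * e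
    0<e′ = subst (_< 1/ b * e) (*-zeroʳ (1/ b))
      (*-monoʳ-<-pos (1/ b) {{1/pos⇒pos b}} 0<e)
    eq : b * (1/ b * e) ≡ e
    eq = trans (sym (*-assoc b (1/ b) e))
      (trans (cong (_* e) (*-inverseʳ b)) (*-identityˡ e))

  const-cauchy : ∀ q → IsCauchy (λ _ → q)
  const-cauchy q = mkCauchy λ e 0<e → 0 , λ _ _ _ _ →
    subst (_≤ e) (sym (cong ∣_∣ (+-inverseʳ q))) (<⇒≤ 0<e)

  cauchy-from-base : ∀ {s} →
    (∀ e → 0ℚ < e → Σ[ N ∈ ℕ ] (∀ n → N ℕ.≤ n → ∣ s n - s N ∣ ≤ e)) → IsCauchy s
  cauchy-from-base {s} h = mkCauchy λ e 0<e →
    let (N , close) = h (e * ½) (0<half 0<e) in N , λ m n N≤m N≤n → begin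
    ∣ s m - s n ∣                    ≤⟨ triangle (s m) (s N) (s n) ⟩
    ∣ s m - s N ∣ + ∣ s N - s n ∣    ≡⟨ cong (∣ s m - s N ∣ +_) (∣-∣-comm (s N) (s n)) ⟩
    ∣ s m - s N ∣ + ∣ s n - s N ∣    ≤⟨ +-mono-≤ (close m N≤m) (close n N≤n) ⟩
    e * ½ + e * ½                    ≡⟨ halve e ⟩
    e                                ∎

  nonexpansive-cauchy : ∀ (g : ℚ → ℚ) → (∀ p q → ∣ g p - g q ∣ ≤ ∣ p - q ∣) →
    ∀ {s} → IsCauchy s → IsCauchy (λ n → g (s n))
  nonexpansive-cauchy g h {s} cs = mkCauchy λ e 0<e →
    let (N , close) = near cs e 0<e
    in N , λ m n N≤m N≤n → ≤-trans (h (s m) (s n)) (close m n N≤m N≤n)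

  +-cauchy : ∀ {s t} → IsCauchy s → IsCauchy t → IsCauchy (λ n → s n + t n)
  +-cauchy {s} {t} cs ct = mkCauchy λ e 0<e →
    let (N₁ , near₁) = near cs (e * ½) (0<half 0<e)
        (N₂ , near₂) = near ct (e * ½) (0<half 0<e)
    in N₁ ℕ.⊔ N₂ , λ m n N≤m N≤n → begin
    ∣ (s m + t m) - (s n + t n) ∣
      ≡⟨ cong ∣_∣ (solve 4 (λ a b c d → (a :+ b) :- (c :+ d) := (a :- c) :+ (b :- d))
                     refl (s m) (t m) (s n) (t n)) ⟩
    ∣ (s m - s n) + (t m - t n) ∣
      ≤⟨ ∣p+q∣≤∣p∣+∣q∣ (s m - s n) (t m - t n) ⟩
    ∣ s m - s n ∣ + ∣ t m - t n ∣
      ≤⟨ +-mono-≤ (near₁ m n (ℕ.m⊔n≤o⇒m≤o N₁ N₂ N≤m) (ℕ.m⊔n≤o⇒m≤o N₁ N₂ N≤n))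
                  (near₂ m n (ℕ.m⊔n≤o⇒n≤o N₁ N₂ N≤m) (ℕ.m⊔n≤o⇒n≤o N₁ N₂ N≤n)) ⟩
    e * ½ + e * ½ ≡⟨ halve e ⟩
    e ∎

  neg-cauchy : ∀ {s} → IsCauchy s → IsCauchy (λ n → - s n)
  neg-cauchy = nonexpansive-cauchy -_ λ p q → ≤-reflexive
    (trans (cong ∣_∣ (solve 2 (λ a b → :- a :- :- b := b :- a) refl p q)) (∣-∣-comm q p))

  abs-cauchy : ∀ {s} → IsCauchy s → IsCauchy (λ n → ∣ s n ∣)
  abs-cauchy = nonexpansive-cauchy ∣_∣ λ p q → ∣∣≤ (half p q)
    (subst₂ _≤_ (solve 2 (λ a b → b :- a := :- (a :- b)) refl ∣ p ∣ ∣ q ∣) (∣-∣-comm q p)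
      (half q p))
    where
    half : ∀ p q → ∣ p ∣ - ∣ q ∣ ≤ ∣ p - q ∣
    half p q = p≤q+r⇒p-q≤r (subst (λ z → ∣ z ∣ ≤ ∣ q ∣ + ∣ p - q ∣)
      (solve 2 (λ a b → b :+ (a :- b) := a) refl p q) (∣p+q∣≤∣p∣+∣q∣ q (p - q)))

  bounded : ∀ {s} → IsCauchy s → Σ[ B ∈ ℕ ] Eventually (λ n → ∣ s n ∣ ≤ fromℕℚ B)
  bounded {s} c =
    let (N , close) = near c 1ℚ (positive⁻¹ 1ℚ)
        (B , le)    = archimedean (∣ s N ∣ + 1ℚ)
    in B , N , λ n N≤n → begin
    ∣ s n ∣                  ≡⟨ cong ∣_∣ (solve 2 (λ a b → a := b :+ (a :- b)) refl (s n) (s N)) ⟩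
    ∣ s N + (s n - s N) ∣    ≤⟨ ∣p+q∣≤∣p∣+∣q∣ (s N) (s n - s N) ⟩
    ∣ s N ∣ + ∣ s n - s N ∣  ≤⟨ +-monoʳ-≤ ∣ s N ∣ (close n N N≤n ℕ.≤-refl) ⟩
    ∣ s N ∣ + 1ℚ             ≤⟨ le ⟩
    fromℕℚ B                 ∎

  *-cauchy : ∀ {s t} → IsCauchy s → IsCauchy t → IsCauchy (λ n → s n * t n)
  *-cauchy {s} {t} cs ct = mkCauchy λ e 0<e →
    let (B  , N₀ , s≤B)    = bounded cs
        (B′ , N₁ , t≤B′)   = bounded ct
        (δ  , 0<δ , eq)    = shrink (0<fromℕℚ-suc (B ℕ.+ B′)) 0<e
        (N₂ , near₁)       = near cs δ 0<δ
        (N₃ , near₂)       = near ct δ 0<δ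
        N                  = (N₀ ℕ.⊔ N₁) ℕ.⊔ (N₂ ℕ.⊔ N₃)
        N₀≤ = λ {n} (h : N ℕ.≤ n) → ℕ.m⊔n≤o⇒m≤o N₀ N₁ (ℕ.m⊔n≤o⇒m≤o (N₀ ℕ.⊔ N₁) _ h)
        N₁≤ = λ {n} (h : N ℕ.≤ n) → ℕ.m⊔n≤o⇒n≤o N₀ N₁ (ℕ.m⊔n≤o⇒m≤o (N₀ ℕ.⊔ N₁) _ h)
        N₂≤ = λ {n} (h : N ℕ.≤ n) → ℕ.m⊔n≤o⇒m≤o N₂ N₃ (ℕ.m⊔n≤o⇒n≤o (N₀ ℕ.⊔ N₁) _ h)
        N₃≤ = λ {n} (h : N ℕ.≤ n) → ℕ.m⊔n≤o⇒n≤o N₂ N₃ (ℕ.m⊔n≤o⇒n≤o (N₀ ℕ.⊔ N₁) _ h)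
    in N , λ m n N≤m N≤n → begin
    ∣ s m * t m - s n * t n ∣
      ≡⟨ cong ∣_∣ (solve 4 (λ a b c d → a :* b :- c :* d := a :* (b :- d) :+ d :* (a :- c))
                     refl (s m) (t m) (s n) (t n)) ⟩
    ∣ s m * (t m - t n) + t n * (s m - s n) ∣
      ≤⟨ ∣p+q∣≤∣p∣+∣q∣ (s m * (t m - t n)) (t n * (s m - s n)) ⟩
    ∣ s m * (t m - t n) ∣ + ∣ t n * (s m - s n) ∣
      ≡⟨ cong₂ _+_ (∣p*q∣≡∣p∣*∣q∣ (s m) _) (∣p*q∣≡∣p∣*∣q∣ (t n) _) ⟩
    ∣ s m ∣ * ∣ t m - t n ∣ + ∣ t n ∣ * ∣ s m - s n ∣
      ≤⟨ +-mono-≤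
           (*-mono-≤₀ (0≤∣p∣ _) (0≤fromℕℚ B) (s≤B m (N₀≤ N≤m)) (near₂ m n (N₃≤ N≤m) (N₃≤ N≤n)))
           (*-mono-≤₀ (0≤∣p∣ _) (0≤fromℕℚ B′) (t≤B′ n (N₁≤ N≤n)) (near₁ m n (N₂≤ N≤m) (N₂≤ N≤n))) ⟩
    fromℕℚ B * δ + fromℕℚ B′ * δ
      ≡⟨ *-distribʳ-+ δ (fromℕℚ B) (fromℕℚ B′) ⟨
    (fromℕℚ B + fromℕℚ B′) * δ
      ≡⟨ cong (_* δ) (fromℕℚ-+ B B′) ⟨
    fromℕℚ (B ℕ.+ B′) * δ
      ≤⟨ *-monoʳ₀ (<⇒≤ 0<δ) (fromℕℚ-mono (ℕ.n≤1+n (B ℕ.+ B′))) ⟩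
    fromℕℚ (suc (B ℕ.+ B′)) * δ
      ≡⟨ eq ⟩
    e ∎

  ^-cauchy : ∀ {s} → IsCauchy s → ∀ k → IsCauchy (λ n → s n ^ℚ k)
  ^-cauchy c zero    = const-cauchy 1ℚ
  ^-cauchy c (suc k) = *-cauchy c (^-cauchy c k)

  ∣^∣ : ∀ p n → ∣ p ^ℚ n ∣ ≡ ∣ p ∣ ^ℚ n
  ∣^∣ p zero    = refl
  ∣^∣ p (suc n) = trans (∣p*q∣≡∣p∣*∣q∣ p (p ^ℚ n)) (cong (∣ p ∣ *_) (∣^∣ p n))

  ^-mono : ∀ {p q} → 0ℚ ≤ p → p ≤ q → ∀ n → p ^ℚ n ≤ q ^ℚ n
  ^-mono 0≤p p≤q zero    = ≤-refl
  ^-mono 0≤p p≤q (suc n) =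
    *-mono-≤₀ (0≤^ 0≤p n) (≤-trans 0≤p p≤q) p≤q (^-mono 0≤p p≤q n)

  psum-tail : ∀ (s t : ℕ → ℚ) → (∀ m → ∣ s m ∣ ≤ t m) → ∀ N j →
    ∣ psum s (j ℕ.+ N) - psum s N ∣ ≤ psum t (j ℕ.+ N) - psum t N
  psum-tail s t h N zero = ≤-reflexive (trans (cong ∣_∣ (+-inverseʳ (psum s N)))
    (sym (+-inverseʳ (psum t N))))
  psum-tail s t h N (suc j) = begin
    ∣ S + s k - psum s N ∣
      ≡⟨ cong ∣_∣ (solve 3 (λ a b c → a :+ b :- c := (a :- c) :+ b) refl S (s k) (psum s N)) ⟩
    ∣ (S - psum s N) + s k ∣      ≤⟨ ∣p+q∣≤∣p∣+∣q∣ (S - psum s N) (s k) ⟩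
    ∣ S - psum s N ∣ + ∣ s k ∣    ≤⟨ +-mono-≤ (psum-tail s t h N j) (h k) ⟩
    (T - psum t N) + t k
      ≡⟨ solve 3 (λ a b c → (a :- c) :+ b := a :+ b :- c) refl T (t k) (psum t N) ⟩
    T + t k - psum t N            ∎
    where
    k = j ℕ.+ N
    S = psum s k
    T = psum t k

  -- Ratio test: ratio at most B / (B + 1) from index M on.
  ratio-test : ∀ (t : ℕ → ℚ) (B M : ℕ) → (∀ m → 0ℚ ≤ t m) →
    (∀ m → M ℕ.≤ m → fromℕℚ (suc B) * t (suc m) ≤ fromℕℚ B * t m) →
    IsCauchy (psum t)
  ratio-test t B M 0≤t ratio = cauchy-from-base small
    where
    B₁ : ℚ
    B₁ = fromℕℚ (suc B)

    0≤B₁ : 0ℚ ≤ B₁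
    0≤B₁ = 0≤fromℕℚ (suc B)

    tail : ∀ N → M ℕ.≤ N → ∀ j →
      psum t (j ℕ.+ N) + B₁ * t (j ℕ.+ N) ≤ psum t N + B₁ * t N
    tail N M≤N zero    = ≤-refl
    tail N M≤N (suc j) = begin
      psum t k + t k + B₁ * t (suc k)
        ≤⟨ +-monoʳ-≤ (psum t k + t k) (ratio k (ℕ.≤-trans M≤N (ℕ.m≤n+m N j))) ⟩
      psum t k + t k + fromℕℚ B * t k
        ≡⟨ solve 3 (λ a b c → a :+ b :+ c :* b := a :+ (con 1ℚ :+ c) :* b)
             refl (psum t k) (t k) (fromℕℚ B) ⟩
      psum t k + (1ℚ + fromℕℚ B) * t k
        ≡⟨ cong (λ z → psum t k + z * t k) (fromℕℚ-suc B) ⟨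
      psum t k + B₁ * t k
        ≤⟨ tail N M≤N j ⟩
      psum t N + B₁ * t N ∎
      where k = j ℕ.+ N

    step : ∀ j → B ℕ.* (suc j ℕ.+ B) ℕ.≤ (j ℕ.+ B) ℕ.* suc B
    step j = subst₂ ℕ._≤_ (sym (ℕ.*-suc B (j ℕ.+ B)))
      (trans (cong (j ℕ.+ B ℕ.+_) (ℕ.*-comm B (j ℕ.+ B))) (sym (ℕ.*-suc (j ℕ.+ B) B)))
      (ℕ.+-monoˡ-≤ _ (ℕ.m≤n+m B j))

    decay : ∀ j → fromℕℚ (j ℕ.+ B) * t (j ℕ.+ M) ≤ fromℕℚ B * t M
    decay zero    = ≤-refl
    decay (suc j) = *-cancelˡ-≤-pos B₁ {{positive (0<fromℕℚ-suc B)}} (begin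
      B₁ * (J₁ * t (suc k))             ≡⟨ solve 3 (λ a b c → a :* (b :* c) := b :* (a :* c))
                                             refl B₁ J₁ (t (suc k)) ⟩
      J₁ * (B₁ * t (suc k))             ≤⟨ *-monoˡ₀ (0≤fromℕℚ (suc j ℕ.+ B))
                                             (ratio k (ℕ.m≤n+m M j)) ⟩
      J₁ * (fromℕℚ B * t k)             ≡⟨ solve 3 (λ a b c → a :* (b :* c) := (b :* a) :* c)
                                             refl J₁ (fromℕℚ B) (t k) ⟩
      fromℕℚ B * J₁ * t k               ≡⟨ cong (_* t k) (fromℕℚ-* B (suc j ℕ.+ B)) ⟨
      fromℕℚ (B ℕ.* (suc j ℕ.+ B)) * t k ≤⟨ *-monoʳ₀ (0≤t k) (fromℕℚ-mono (step j)) ⟩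
      fromℕℚ ((j ℕ.+ B) ℕ.* suc B) * t k ≡⟨ cong (_* t k) (fromℕℚ-* (j ℕ.+ B) (suc B)) ⟩
      J * B₁ * t k                      ≡⟨ solve 3 (λ a b c → a :* b :* c := b :* (a :* c))
                                             refl J B₁ (t k) ⟩
      B₁ * (J * t k)                    ≤⟨ *-monoˡ₀ 0≤B₁ (decay j) ⟩
      B₁ * (fromℕℚ B * t M)             ∎)
      where
      k  = j ℕ.+ M
      J  = fromℕℚ (j ℕ.+ B)
      J₁ = fromℕℚ (suc j ℕ.+ B)

    tail-small : ∀ e → 0ℚ < e → Σ[ N ∈ ℕ ] (M ℕ.≤ N × B₁ * t N ≤ e)
    tail-small e 0<e =
      let (r , 0<r , er≡1) = shrink 0<e (positive⁻¹ 1ℚ)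
          X = B₁ * (fromℕℚ B * t M)
          (j₀ , le) = archimedean (X * r)
          j = suc j₀
          J = fromℕℚ (j ℕ.+ B)
          j₀≤J = ℕ.≤-trans (ℕ.n≤1+n j₀) (ℕ.m≤m+n j B)
      in j ℕ.+ M , ℕ.m≤n+m M j , *-cancelˡ-≤-pos J {{positive (0<fromℕℚ-suc (j₀ ℕ.+ B))}} (begin
      J * (B₁ * t (j ℕ.+ M))
        ≡⟨ solve 3 (λ a b c → a :* (b :* c) := b :* (a :* c)) refl J B₁ (t (j ℕ.+ M)) ⟩
      B₁ * (J * t (j ℕ.+ M))              ≤⟨ *-monoˡ₀ 0≤B₁ (decay j) ⟩
      X                                   ≡⟨ *-identityʳ X ⟨
      X * 1ℚ                              ≡⟨ cong (X *_) er≡1 ⟨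
      X * (e * r)                         ≡⟨ solve 3 (λ a b c → a :* (b :* c) := (a :* c) :* b)
                                               refl X e r ⟩
      X * r * e                           ≤⟨ *-monoʳ₀ (<⇒≤ 0<e) (≤-trans le (fromℕℚ-mono j₀≤J)) ⟩
      J * e                               ∎)

    tail-bound : ∀ N → M ℕ.≤ N → ∀ e → B₁ * t N ≤ e → ∀ j →
      ∣ psum t (j ℕ.+ N) - psum t N ∣ ≤ e
    tail-bound N M≤N e le j = begin
      ∣ psum t (j ℕ.+ N) - psum t N ∣
        ≤⟨ psum-tail t t (λ m → ≤-reflexive (0≤p⇒∣p∣≡p (0≤t m))) N j ⟩
      psum t (j ℕ.+ N) - psum t N
        ≤⟨ p≤q+r⇒p-q≤r {psum t (j ℕ.+ N)} {psum t N} (≤-trans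
             (subst (_≤ psum t (j ℕ.+ N) + B₁ * t (j ℕ.+ N)) (+-identityʳ _)
               (+-monoʳ-≤ (psum t (j ℕ.+ N)) (0≤* 0≤B₁ (0≤t (j ℕ.+ N)))))
             (tail N M≤N j)) ⟩
      B₁ * t N ≤⟨ le ⟩
      e ∎

    small : ∀ e → 0ℚ < e → Σ[ N ∈ ℕ ] (∀ n → N ℕ.≤ n → ∣ psum t n - psum t N ∣ ≤ e)
    small e 0<e =
      let (N , M≤N , le) = tail-small e 0<e
      in N , λ n N≤n → subst (λ n → ∣ psum t n - psum t N ∣ ≤ e)
           (ℕ.m∸n+n≡m N≤n) (tail-bound N M≤N e le (n ∸ N))

  poly-cauchy : ∀ (c : ℕ → ℚ) {s} → IsCauchy s → ∀ N →
    IsCauchy (λ i → psum (λ m → c m * s i ^ℚ m) N)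
  poly-cauchy c cs zero    = const-cauchy 0ℚ
  poly-cauchy c cs (suc N) =
    +-cauchy (poly-cauchy c cs N) (*-cauchy (const-cauchy (c N)) (^-cauchy cs N))

  -- If ∑ c m * R ^ m converges, so does n ↦ ∑_{m < n} c m * (s n) ^ m
  -- for every Cauchy sequence s eventually bounded by R.
  series-cauchy : ∀ (c : ℕ → ℚ) → (∀ m → 0ℚ ≤ c m) → ∀ {s} → IsCauchy s → ∀ R →
    Eventually (λ n → ∣ s n ∣ ≤ R) → IsCauchy (psum (λ m → c m * R ^ℚ m)) →
    IsCauchy (λ n → psum (λ m → c m * s n ^ℚ m) n)
  series-cauchy c 0≤c {s} cs R (N₀ , s≤R) conv = cauchy-from-base settle
    where
    a : ℕ → ℕ → ℚ
    a i m = c m * s i ^ℚ m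

    t : ℕ → ℚ
    t m = c m * R ^ℚ m

    a≤t : ∀ i → N₀ ℕ.≤ i → ∀ m → ∣ a i m ∣ ≤ t m
    a≤t i h m = begin
      ∣ c m * s i ^ℚ m ∣       ≡⟨ ∣p*q∣≡∣p∣*∣q∣ (c m) (s i ^ℚ m) ⟩
      ∣ c m ∣ * ∣ s i ^ℚ m ∣   ≡⟨ cong₂ _*_ (0≤p⇒∣p∣≡p (0≤c m)) (∣^∣ (s i) m) ⟩
      c m * ∣ s i ∣ ^ℚ m       ≤⟨ *-monoˡ₀ (0≤c m) (^-mono (0≤∣p∣ (s i)) (s≤R i h) m) ⟩
      c m * R ^ℚ m             ∎

    settle : ∀ e → 0ℚ < e → Σ[ N ∈ ℕ ] (∀ n → N ℕ.≤ n → ∣ psum (a n) n - psum (a N) N ∣ ≤ e)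
    settle e 0<e with near conv (e * ½ * ½) (0<half (0<half 0<e))
    ... | N₁ , tail with near (poly-cauchy c cs N₁) (e * ½) (0<half 0<e)
    ... | N₂ , near-poly = N , close
      where
      h : ℚ
      h = e * ½ * ½

      N : ℕ
      N = N₀ ℕ.⊔ (N₁ ℕ.⊔ N₂)

      N₀≤N : N₀ ℕ.≤ N
      N₀≤N = ℕ.m≤m⊔n N₀ _
      N₁≤N : N₁ ℕ.≤ N
      N₁≤N = ℕ.≤-trans (ℕ.m≤m⊔n N₁ N₂) (ℕ.m≤n⊔m N₀ _)
      N₂≤N : N₂ ℕ.≤ N
      N₂≤N = ℕ.≤-trans (ℕ.m≤n⊔m N₁ N₂) (ℕ.m≤n⊔m N₀ _)

      head : ∀ n → N ℕ.≤ n → ∣ psum (a n) n - psum (a n) N₁ ∣ ≤ h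
      head n N≤n = subst (λ k → ∣ psum (a n) k - psum (a n) N₁ ∣ ≤ h)
        (ℕ.m∸n+n≡m (ℕ.≤-trans N₁≤N N≤n)) (begin
          ∣ psum (a n) k - psum (a n) N₁ ∣
            ≤⟨ psum-tail (a n) t (a≤t n (ℕ.≤-trans N₀≤N N≤n)) N₁ (n ∸ N₁) ⟩
          psum t k - psum t N₁        ≤⟨ p≤∣p∣ (psum t k - psum t N₁) ⟩
          ∣ psum t k - psum t N₁ ∣    ≤⟨ tail k N₁ (ℕ.m≤n+m N₁ (n ∸ N₁)) ℕ.≤-refl ⟩
          h                           ∎)
        where
        k = n ∸ N₁ ℕ.+ N₁

      close : ∀ n → N ℕ.≤ n → ∣ psum (a n) n - psum (a N) N ∣ ≤ e
      close n N≤n = begin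
        ∣ psum (a n) n - psum (a N) N ∣
          ≤⟨ triangle (psum (a n) n) (psum (a n) N₁) (psum (a N) N) ⟩
        ∣ psum (a n) n - psum (a n) N₁ ∣ + ∣ psum (a n) N₁ - psum (a N) N ∣
          ≤⟨ +-mono-≤ (head n N≤n) (triangle (psum (a n) N₁) (psum (a N) N₁) (psum (a N) N)) ⟩
        h + (∣ psum (a n) N₁ - psum (a N) N₁ ∣ + ∣ psum (a N) N₁ - psum (a N) N ∣)
          ≤⟨ +-monoʳ-≤ h (+-mono-≤
               (near-poly n N (ℕ.≤-trans N₂≤N N≤n) N₂≤N)
               (subst (_≤ h) (∣-∣-comm (psum (a N) N) (psum (a N) N₁)) (head N ℕ.≤-refl))) ⟩
        h + (e * ½ + h)
          ≡⟨ solve 2 (λ x y → x :+ (y :+ x) := (x :+ x) :+ y) refl h (e * ½) ⟩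
        (h + h) + e * ½   ≡⟨ cong (_+ e * ½) (halve (e * ½)) ⟩
        e * ½ + e * ½     ≡⟨ halve e ⟩
        e                 ∎

  expCoeff : ℕ → ℚ
  expCoeff m = (ℤ.+ 1 / (m !)) {{m ℕ.!≢0}}

  0≤expCoeff : ∀ m → 0ℚ ≤ expCoeff m
  0≤expCoeff m = 0≤recip (m !) {{m ℕ.!≢0}}

  expCoeff-suc : ∀ m → fromℕℚ (suc m) * expCoeff (suc m) ≡ expCoeff m
  expCoeff-suc m = cancel (fromℕℚ (suc m)) (expCoeff (suc m)) (expCoeff m) (fromℕℚ (m !))
    (trans (cong (_* expCoeff (suc m)) (sym (fromℕℚ-* (suc m) (m !))))
      (fromℕℚ-recip (suc m !) {{suc m ℕ.!≢0}}))
    (fromℕℚ-recip (m !) {{m ℕ.!≢0}})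
    where
    cancel : ∀ n u v f → n * f * u ≡ 1ℚ → f * v ≡ 1ℚ → n * u ≡ v
    cancel n u v f nfu≡1 fv≡1 = begin-equality
      n * u              ≡⟨ *-identityʳ (n * u) ⟨
      n * u * 1ℚ         ≡⟨ cong (n * u *_) fv≡1 ⟨
      n * u * (f * v)    ≡⟨ solve 4 (λ n u v f → n :* u :* (f :* v) := n :* f :* u :* v)
                              refl n u v f ⟩
      n * f * u * v      ≡⟨ cong (_* v) nfu≡1 ⟩
      1ℚ * v             ≡⟨ *-identityˡ v ⟩
      v                  ∎

  exp-ratio : ∀ B m → 2 ℕ.* B ℕ.≤ m →
    fromℕℚ 2 * (expCoeff (suc m) * fromℕℚ B ^ℚ suc m) ≤ fromℕℚ 1 * (expCoeff m * fromℕℚ B ^ℚ m)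
  exp-ratio B m 2B≤m = ratio (fromℕℚ 2) (fromℕℚ B) (fromℕℚ (suc m)) (expCoeff (suc m))
    (expCoeff m) (fromℕℚ B ^ℚ m) (0≤expCoeff (suc m)) (0≤^ (0≤fromℕℚ B) m)
    (subst (_≤ fromℕℚ (suc m)) (fromℕℚ-* 2 B) (fromℕℚ-mono (ℕ.m≤n⇒m≤1+n 2B≤m)))
    (expCoeff-suc m)
    where
    ratio : ∀ two b n u v r → 0ℚ ≤ u → 0ℚ ≤ r → two * b ≤ n → n * u ≡ v →
      two * (u * (b * r)) ≤ 1ℚ * (v * r)
    ratio two b n u v r 0≤u 0≤r 2b≤n nu≡v = begin
      two * (u * (b * r))   ≡⟨ solve 4 (λ t b u r → t :* (u :* (b :* r)) := t :* b :* (u :* r))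
                                 refl two b u r ⟩
      two * b * (u * r)     ≤⟨ *-monoʳ₀ (0≤* 0≤u 0≤r) 2b≤n ⟩
      n * (u * r)           ≡⟨ *-assoc n u r ⟨
      n * u * r             ≡⟨ cong (_* r) nu≡v ⟩
      v * r                 ≡⟨ *-identityˡ (v * r) ⟨
      1ℚ * (v * r)          ∎

  exp-cauchy : ∀ {s} → IsCauchy s → IsCauchy (λ n → psum (λ m → expCoeff m * s n ^ℚ m) n)
  exp-cauchy {s} cs =
    let (B , s≤B) = bounded cs
    in series-cauchy expCoeff 0≤expCoeff {s} cs (fromℕℚ B) s≤B
         (ratio-test (λ m → expCoeff m * fromℕℚ B ^ℚ m) 1 (2 ℕ.* B)
           (λ m → 0≤* (0≤expCoeff m) (0≤^ (0≤fromℕℚ B) m))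
           (exp-ratio B))

  1≤1⊔ : ∀ q → 1ℚ ≤ 1ℚ ⊔ q
  1≤1⊔ = p≤p⊔q 1ℚ

  1⊔-positive : ∀ q → Positive (1ℚ ⊔ q)
  1⊔-positive q = positive (<-≤-trans (positive⁻¹ 1ℚ) (1≤1⊔ q))

  1/1⊔ : ℚ → ℚ
  1/1⊔ q = (1/ (1ℚ ⊔ q)) {{pos⇒nonZero (1ℚ ⊔ q) {{1⊔-positive q}}}}

  1/1⊔-inverse : ∀ q → (1ℚ ⊔ q) * 1/1⊔ q ≡ 1ℚ
  1/1⊔-inverse q = *-inverseʳ (1ℚ ⊔ q) {{pos⇒nonZero (1ℚ ⊔ q) {{1⊔-positive q}}}}

  logArg : ℚ → ℚ
  logArg q = 1ℚ - 1/1⊔ q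

  logCoeff : ℕ → ℚ
  logCoeff zero    = 0ℚ
  logCoeff (suc m) = ℤ.+ 1 / suc m

  0≤logCoeff : ∀ m → 0ℚ ≤ logCoeff m
  0≤logCoeff zero    = ≤-refl
  0≤logCoeff (suc m) = 0≤recip (suc m)

  inverse-anti : ∀ a a⁻¹ b b⁻¹ → 0ℚ ≤ a⁻¹ → 0ℚ ≤ b⁻¹ → a * a⁻¹ ≡ 1ℚ → b * b⁻¹ ≡ 1ℚ →
    a ≤ b → b⁻¹ ≤ a⁻¹
  inverse-anti a a⁻¹ b b⁻¹ 0≤a⁻¹ 0≤b⁻¹ aa⁻¹ bb⁻¹ a≤b = begin
    b⁻¹              ≡⟨ *-identityˡ b⁻¹ ⟨
    1ℚ * b⁻¹         ≡⟨ cong (_* b⁻¹) aa⁻¹ ⟨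
    a * a⁻¹ * b⁻¹    ≤⟨ *-monoʳ₀ 0≤b⁻¹ (*-monoʳ₀ 0≤a⁻¹ a≤b) ⟩
    b * a⁻¹ * b⁻¹    ≡⟨ solve 3 (λ b x y → b :* x :* y := b :* y :* x) refl b a⁻¹ b⁻¹ ⟩
    b * b⁻¹ * a⁻¹    ≡⟨ cong (_* a⁻¹) bb⁻¹ ⟩
    1ℚ * a⁻¹         ≡⟨ *-identityˡ a⁻¹ ⟩
    a⁻¹              ∎

  logCoeff-anti : ∀ m → 1 ℕ.≤ m → logCoeff (suc m) ≤ logCoeff m
  logCoeff-anti (suc m) _ = inverse-anti (fromℕℚ (suc m)) (ℤ.+ 1 / suc m)
    (fromℕℚ (suc (suc m))) (ℤ.+ 1 / suc (suc m)) (0≤recip (suc m)) (0≤recip (suc (suc m)))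
    (fromℕℚ-recip (suc m)) (fromℕℚ-recip (suc (suc m))) (fromℕℚ-mono (ℕ.n≤1+n (suc m)))

  0≤1/1⊔ : ∀ q → 0ℚ ≤ 1/1⊔ q
  0≤1/1⊔ q = <⇒≤ (positive⁻¹ (1/1⊔ q) {{1/pos⇒pos (1ℚ ⊔ q) {{1⊔-positive q}}}})

  1/1⊔≤1 : ∀ q → 1/1⊔ q ≤ 1ℚ
  1/1⊔≤1 q = inverse-anti 1ℚ 1ℚ (1ℚ ⊔ q) (1/1⊔ q) (nonNegative⁻¹ 1ℚ) (0≤1/1⊔ q)
    refl (1/1⊔-inverse q) (1≤1⊔ q)

  0≤logArg : ∀ q → 0ℚ ≤ logArg q
  0≤logArg q = p≤q⇒0≤q-p {1/1⊔ q} (1/1⊔≤1 q)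

  logArg-nonexpansive : ∀ p q → ∣ logArg p - logArg q ∣ ≤ ∣ p - q ∣
  logArg-nonexpansive p q = begin
    ∣ logArg p - logArg q ∣   ≡⟨ cong ∣_∣ (diff a x b y (1/1⊔-inverse p) (1/1⊔-inverse q)) ⟩
    ∣ (a - b) * (x * y) ∣     ≡⟨ ∣p*q∣≡∣p∣*∣q∣ (a - b) (x * y) ⟩
    ∣ a - b ∣ * ∣ x * y ∣     ≤⟨ *-mono-≤₀ (0≤∣p∣ (x * y)) (0≤∣p∣ (p - q))
                                  (∣∣≤ (clamp p q) (subst₂ _≤_
                                     (solve 2 (λ a b → b :- a := :- (a :- b)) refl a b)
                                     (∣-∣-comm q p) (clamp q p)))
                                  xy≤1 ⟩
    ∣ p - q ∣ * 1ℚ            ≡⟨ *-identityʳ ∣ p - q ∣ ⟩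
    ∣ p - q ∣                 ∎
    where
    a = 1ℚ ⊔ p
    b = 1ℚ ⊔ q
    x = 1/1⊔ p
    y = 1/1⊔ q
    diff : ∀ a x b y → a * x ≡ 1ℚ → b * y ≡ 1ℚ → (1ℚ - x) - (1ℚ - y) ≡ (a - b) * (x * y)
    diff a x b y ax by = begin-equality
      (1ℚ - x) - (1ℚ - y)
        ≡⟨ solve 2 (λ x y → (con 1ℚ :- x) :- (con 1ℚ :- y) := con 1ℚ :* y :- con 1ℚ :* x) refl x y ⟩
      1ℚ * y - 1ℚ * x           ≡⟨ cong₂ (λ u v → u * y - v * x) ax by ⟨
      a * x * y - b * y * x
        ≡⟨ solve 4 (λ a x b y → a :* x :* y :- b :* y :* x := (a :- b) :* (x :* y)) refl a x b y ⟩
      (a - b) * (x * y)         ∎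
    xy≤1 : ∣ x * y ∣ ≤ 1ℚ
    xy≤1 = subst (_≤ 1ℚ) (sym (0≤p⇒∣p∣≡p (0≤* (0≤1/1⊔ p) (0≤1/1⊔ q))))
      (*-mono-≤₀ {x} {1ℚ} {y} {1ℚ} (0≤1/1⊔ q) (nonNegative⁻¹ 1ℚ) (1/1⊔≤1 p) (1/1⊔≤1 q))
    clamp : ∀ p q → (1ℚ ⊔ p) - (1ℚ ⊔ q) ≤ ∣ p - q ∣
    clamp p q = p≤q+r⇒p-q≤r {1ℚ ⊔ p} {1ℚ ⊔ q} (⊔-lub {_} {1ℚ} {p}
      (subst (_≤ (1ℚ ⊔ q) + ∣ p - q ∣) (+-identityʳ 1ℚ) (+-mono-≤ (1≤1⊔ q) (0≤∣p∣ (p - q))))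
      (begin
        p                        ≡⟨ solve 2 (λ p q → p := q :+ (p :- q)) refl p q ⟩
        q + (p - q)              ≤⟨ +-mono-≤ (p≤q⊔p 1ℚ q) (p≤∣p∣ (p - q)) ⟩
        (1ℚ ⊔ q) + ∣ p - q ∣     ∎))

  logRadius : ℕ → ℚ
  logRadius B = 1ℚ - ℤ.+ 1 / suc B

  0≤logRadius : ∀ B → 0ℚ ≤ logRadius B
  0≤logRadius B = p≤q⇒0≤q-p {ℤ.+ 1 / suc B} (inverse-anti 1ℚ 1ℚ (fromℕℚ (suc B)) (ℤ.+ 1 / suc B)
    (nonNegative⁻¹ 1ℚ) (0≤recip (suc B)) refl (fromℕℚ-recip (suc B))
    (fromℕℚ-mono {1} {suc B} (ℕ.s≤s ℕ.z≤n)))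

  logArg-bound : ∀ B q → ∣ q ∣ ≤ fromℕℚ B → ∣ logArg q ∣ ≤ logRadius B
  logArg-bound B q q≤B = subst (_≤ logRadius B) (sym (0≤p⇒∣p∣≡p (0≤logArg q)))
    (+-monoʳ-≤ 1ℚ (neg-antimono-≤ (inverse-anti (1ℚ ⊔ q) (1/1⊔ q) (fromℕℚ (suc B))
      (ℤ.+ 1 / suc B) (0≤1/1⊔ q) (0≤recip (suc B)) (1/1⊔-inverse q) (fromℕℚ-recip (suc B))
      (⊔-lub {_} {1ℚ} {q} (fromℕℚ-mono {1} {suc B} (ℕ.s≤s ℕ.z≤n))
             (≤-trans (p≤∣p∣ q) (≤-trans q≤B (fromℕℚ-mono (ℕ.n≤1+n B))))))))

  log-ratio : ∀ B m → 1 ℕ.≤ m →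
    fromℕℚ (suc B) * (logCoeff (suc m) * logRadius B ^ℚ suc m) ≤
    fromℕℚ B * (logCoeff m * logRadius B ^ℚ m)
  log-ratio B m 1≤m = ratio (fromℕℚ B) (fromℕℚ (suc B)) (ℤ.+ 1 / suc B) (logCoeff (suc m))
    (logCoeff m) (logRadius B ^ℚ m) (0≤fromℕℚ B) (0≤^ (0≤logRadius B) m) (logCoeff-anti m 1≤m)
    (fromℕℚ-suc B) (fromℕℚ-recip (suc B))
    where
    ratio : ∀ b b₁ i u v r → 0ℚ ≤ b → 0ℚ ≤ r → u ≤ v → b₁ ≡ 1ℚ + b → b₁ * i ≡ 1ℚ →
      b₁ * (u * ((1ℚ - i) * r)) ≤ b * (v * r)
    ratio b b₁ i u v r 0≤b 0≤r u≤v b₁≡ b₁i≡1 = begin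
      b₁ * (u * ((1ℚ - i) * r))
        ≡⟨ solve 4 (λ b i u r → b :* (u :* ((con 1ℚ :- i) :* r)) := (b :- b :* i) :* (u :* r))
             refl b₁ i u r ⟩
      (b₁ - b₁ * i) * (u * r)       ≡⟨ cong₂ (λ p q → (p - q) * (u * r)) b₁≡ b₁i≡1 ⟩
      (1ℚ + b - 1ℚ) * (u * r)
        ≡⟨ solve 2 (λ b x → (con 1ℚ :+ b :- con 1ℚ) :* x := b :* x) refl b (u * r) ⟩
      b * (u * r)                   ≤⟨ *-monoˡ₀ 0≤b (*-monoʳ₀ 0≤r u≤v) ⟩
      b * (v * r)                   ∎

  log-cauchy : ∀ {s} → IsCauchy s →
    IsCauchy (λ n → psum (λ m → logCoeff m * logArg (s n) ^ℚ m) n)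
  log-cauchy {s} cs =
    let (B , N , s≤B) = bounded cs
    in series-cauchy logCoeff 0≤logCoeff {λ n → logArg (s n)}
         (nonexpansive-cauchy logArg logArg-nonexpansive cs) (logRadius B)
         (N , λ n N≤n → logArg-bound B (s n) (s≤B n N≤n))
         (ratio-test (λ m → logCoeff m * logRadius B ^ℚ m) B 1
           (λ m → 0≤* (0≤logCoeff m) (0≤^ (0≤logRadius B) m))
           (log-ratio B))

open CauchyProperties


-- Cauchy sequences of rationals; real numbers are compared with _≃_.
record ℝ : Set where
  constructor mkℝ
  field
    seq    : ℕ → ℚ
    cauchy : IsCauchy seq

open ℝ public

infix  4 _≃_ _≤_ _<_
infixl 6 _+_ _-_
infixl 7 _*_
infix  8 -_
infixr 8 _^_

record _≃_ (x y : ℝ) : Set where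
  constructor mk≃
  field
    eventually-near : ∀ e → 0ℚ ℚ.< e → Eventually (λ n → ℚ.∣ seq x n ℚ.- seq y n ∣ ℚ.≤ e)

record _≤_ (x y : ℝ) : Set where
  constructor mk≤
  field
    eventually-≤ : ∀ e → 0ℚ ℚ.< e → Eventually (λ n → seq x n ℚ.≤ seq y n ℚ.+ e)

record _<_ (x y : ℝ) : Set where
  constructor mk<
  field
    gap          : ℚ
    0<gap        : 0ℚ ℚ.< gap
    eventually-< : Eventually (λ n → seq x n ℚ.+ gap ℚ.≤ seq y n)

open _≃_ public
open _≤_ public
open _<_ public

fromℚ : ℚ → ℝ
fromℚ q = mkℝ (λ _ → q) (const-cauchy q)

fromℤ : ℤ → ℝ
fromℤ i = fromℚ (i ℚ./ 1)

fromℕ : ℕ → ℝ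
fromℕ n = fromℚ (fromℕℚ n)

0ℝ 1ℝ : ℝ
0ℝ = fromℚ 0ℚ
1ℝ = fromℚ 1ℚ

_+_ : ℝ → ℝ → ℝ
x + y = mkℝ (λ n → seq x n ℚ.+ seq y n) (+-cauchy (cauchy x) (cauchy y))

_*_ : ℝ → ℝ → ℝ
x * y = mkℝ (λ n → seq x n ℚ.* seq y n) (*-cauchy (cauchy x) (cauchy y))

-_ : ℝ → ℝ
- x = mkℝ (λ n → ℚ.- seq x n) (neg-cauchy (cauchy x))

_-_ : ℝ → ℝ → ℝ
x - y = x + - y

∣_∣ : ℝ → ℝ
∣ x ∣ = mkℝ (λ n → ℚ.∣ seq x n ∣) (abs-cauchy (cauchy x))

_^_ : ℝ → ℕ → ℝ
x ^ zero  = 1ℝ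
x ^ suc n = x * x ^ n

∑ : List ℕ → (ℕ → ℝ) → ℝ
∑ l f = foldr (λ i s → f i + s) 0ℝ l

syntax ∑ l (λ i → t) = ∑[ i ∈ l ] t

-- exp x = ∑ xᵐ / m!; the n-th approximation is the n-th partial sum at the
-- n-th approximation of x.
exp : ℝ → ℝ
exp x = mkℝ (λ n → psum (λ m → expCoeff m ℚ.* seq x n ^ℚ m) n) (exp-cauchy (cauchy x))

-- Real numbers x ≥ 1, presented together with their integer part.
-- Classically every real x ≥ 1 is of this form, and the integer part is unique.
-- It is part of the data because it is not computable from x, while the
-- summatory functions below are sums over 1 ≤ n ≤ ⌊ x ⌋.
record ℝ≥1 : Set where
  field
    val     : ℝ
    1≤val   : 1ℝ ≤ val
    ⌊_⌋     : ℕ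
    floor≤  : fromℕ ⌊_⌋ ≤ val
    <1+floor : val < fromℕ (suc ⌊_⌋)

open ℝ≥1 public

-- log x = - log (1 - u) = ∑_{m ≥ 1} uᵐ / m with u = 1 - 1/x ∈ [0 , 1).
-- The rational approximations of x are replaced by their maximum with 1, which
-- does not change x, so that they can be inverted.
log : ℝ≥1 → ℝ
log x = mkℝ (λ n → psum (λ m → logCoeff m ℚ.* logArg (seq (val x) n) ^ℚ m) n)
            (log-cauchy (cauchy (val x)))

infixr 8 _^ℝ_

_^ℝ_ : ℝ≥1 → ℝ → ℝ
x ^ℝ s = exp (s * log x)

-- f x = O(g x) as x → ∞, for nonnegative g.
infix 4 _=O_

_=O_ : (f g : ℝ≥1 → ℝ) → Set
f =O g = Σ[ C ∈ ℝ ] Σ[ X ∈ ℝ ] (∀ x → X ≤ val x → ∣ f x ∣ ≤ C * g x)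

-- m , m + 1 , … , n (empty if n < m)
[_⋯_] : ℕ → ℕ → List ℕ
[ m ⋯ n ] = applyUpTo (m ℕ.+_) (suc n ∸ m)

tuples : List ℕ → (k : ℕ) → List (Vec ℕ k)
tuples l zero    = [] ∷ []
tuples l (suc k) = cartesianProductWith _∷_ l (tuples l k)

-- The number of k-tuples of integers ≥ m (with m ≥ 1) whose product is n ≥ 1;
-- the entries of such a tuple are at most n.
factorizations : (m k n : ℕ) → ℕ
factorizations m k n =
  length (filter (λ v → foldr′ ℕ._*_ 1 v ℕ.≟ n) (tuples [ m ⋯ n ] k))

d f : (k n : ℕ) → ℕ
d = factorizations 1
f = factorizations 2

D F : ℕ → ℝ≥1 → ℝ
D k x = fromℕ (sum (map (d k) [ 1 ⋯ ⌊ x ⌋ ]))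
F k x = fromℕ (sum (map (f k) [ 1 ⋯ ⌊ x ⌋ ]))

-- α j = (j - 1) / j for j ≥ 1; the value at 0 is irrelevant.
α : ℕ → ℚ
α zero    = 0ℚ
α (suc j) = ℤ.+ j ℚ./ suc j

-- β k = max (α 1) … (α k) for k ≥ 1
β : ℕ → ℚ
β k = foldr ℚ._⊔_ (α 1) (map α [ 2 ⋯ k ])

polynomial : (k : ℕ) → (ℕ → ℝ) → ℝ → ℝ
polynomial k c t = ∑[ j ∈ upTo k ] (c j * t ^ j)

-- The numbers a k j (k ≥ 1, j < k) are the coefficients of the main terms in
-- the divisor problem; this determines them, and other values of a are unused.
IsDivisorCoefficients : (ℕ → ℕ → ℝ) → Set
IsDivisorCoefficients a = ∀ k → 1 ℕ.≤ k → ∀ ε → 0ℝ < ε →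
  (λ x → D k x - val x * polynomial k (a k) (log x)) =O (λ x → x ^ℝ (fromℚ (α k) + ε))

b : (ℕ → ℕ → ℝ) → ℕ → ℕ → ℝ
b a k j = ∑[ i ∈ [ suc j ⋯ k ] ] (fromℤ (-1ℤ ℤ.^ (k ∸ i) ℤ.* ℤ.+ (k C i)) * a i j)

Pᶠ : (ℕ → ℕ → ℝ) → ℕ → ℝ → ℝ
Pᶠ a k = polynomial k (b a k)

{-# OPTIONS --safe #-}
module Submission where

-- Fix n and let l = [2 .. n].  Put φ(p) = 1 if p = n and 0 otherwise.  If T is
-- the operator (T φ)(p) = ∑_{q ∈ l} φ(p q), then f_k(n) = (T^k φ)(1), while
-- d_k(n) = ((I + T)^k φ)(1), because prepending 1 to l adds the identity to T.
-- The numbers g(j , i) = (T^j (I + T)^i φ)(1) satisfy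
--   g(j , i + 1) = g(j , i) + g(j + 1 , i),
-- and so do their sums over n ≤ x.  By binomial inversion of this recurrence,
--   F_k(x) = ∑_{i = 0}^{k} (-1)^(k-i) C(k,i) D_i(x)            (seq-F).
-- Exchanging the order of summation over the triangle 0 ≤ j < i ≤ k, the main
-- terms combine in the same way (seq-Pᶠ): P_k^F is the same combination of the
-- divisor polynomials P_i(t) = ∑_{j < i} a_{i,j} t^j, where P_0 = 0.  Hence
-- Δ_k^F(x) = F_k(x) - x P_k^F(log x) is the same combination of the error terms
-- D_i(x) - x P_i(log x) (remainderᶠ≡∑).
--
-- For 1 ≤ i ≤ k the i-th error term is O(x^(α_i + ε)) by hypothesis, hence
-- O(x^(β_k + ε)), since 0 ≤ α_i ≤ β_k and log x ≥ 0.  The term for i = 0 is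
-- D_0(x) ≤ 1 ≤ x^(β_k + ε).  A finite linear combination of functions that are
-- O(g) is O(g), which bounds Δ_k^F.
--
-- Sums, products and powers of reals are formed approximation by approximation,
-- so the identities above hold as equalities of rational sequences.  Likewise
-- the n-th approximation of exp is a partial sum at the n-th approximation of
-- the argument, so exponentials can be compared term by term, without any appeal
-- to the continuity of exp.

open import Defs
open CauchyProperties
open import Data.Bool.Base using (if_then_else_; true; false)
open import Data.Integer.Base as ℤ using (ℤ; -1ℤ)
import Data.Integer.Properties as ℤ
import Data.Integer.Solver
open import Data.List.Base using
  (List; []; _∷_; _++_; map; foldr; filter; length; applyUpTo; upTo; cartesianProductWith)
open import Data.List.Membership.Propositional using (_∈_)
open import Data.List.Membership.Propositional.Properties using (∈-applyUpTo⁺; ∈-map⁺)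
open import Data.List.Properties using (filter-++; filter-≐; length-++; map-cong; map-cong-local)
open import Data.List.Relation.Unary.All using (All; []; _∷_)
import Data.List.Relation.Unary.All.Properties as All
open import Data.List.Relation.Unary.Any using (here; there)
open import Data.Nat.Base as ℕ using (ℕ; zero; suc; _∸_) renaming (_≤_ to _≤ℕ_)
open import Data.Nat.Combinatorics using (_C_; nCk+nC[k+1]≡[n+1]C[k+1]; k>n⇒nCk≡0)
open import Data.Nat.GeneralisedArithmetic using (fold)
open import Data.Nat.ListAction using (sum)
import Data.Nat.Properties as ℕ
import Data.Nat.Solver
open import Data.Product using (Σ-syntax; _×_; _,_; proj₁; proj₂)
open import Data.Rational.Base as ℚ using (ℚ; 0ℚ; 1ℚ; ½)
import Data.Rational.Properties as ℚ
open import Data.Rational.Solver using (module +-*-Solver)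
import Data.Rational.Unnormalised.Base as ℚᵘ
import Data.Rational.Unnormalised.Properties as ℚᵘ
open import Data.Sum using (inj₁; inj₂)
open import Data.Vec.Base using ([]; _∷_; foldr′)
open import Function.Base using (_∘_)
open import Relation.Binary.PropositionalEquality
  using (_≡_; _≗_; refl; sym; trans; cong; cong₂; subst; module ≡-Reasoning)
open import Relation.Nullary using (does; yes; no)
open import Relation.Unary using (Pred; Decidable)

-- Counting tuples by a prescribed product

-- The operator φ ↦ (p ↦ ∑_{q ∈ l} φ(p q)) on functions of a natural number.
dilate : List ℕ → (ℕ → ℕ) → ℕ → ℕ
dilate l φ p = sum (map (λ q → φ (p ℕ.* q)) l)

-- The indicator function of n.
point : ℕ → ℕ → ℕ
point n p = if does (p ℕ.≟ n) then 1 else 0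

dilate-cong : ∀ l {φ ψ} → φ ≗ ψ → dilate l φ ≗ dilate l ψ
dilate-cong l φ≗ψ p = cong sum (map-cong (λ q → φ≗ψ (p ℕ.* q)) l)

sum-map-+ : ∀ {A : Set} (g h : A → ℕ) xs →
  sum (map (λ x → g x ℕ.+ h x) xs) ≡ sum (map g xs) ℕ.+ sum (map h xs)
sum-map-+ g h []       = refl
sum-map-+ g h (x ∷ xs) = trans (cong (g x ℕ.+ h x ℕ.+_) (sum-map-+ g h xs))
  (solve 4 (λ a b c d → a :+ b :+ (c :+ d) := a :+ c :+ (b :+ d)) refl
    (g x) (h x) (sum (map g xs)) (sum (map h xs)))
  where open Data.Nat.Solver.+-*-Solver

dilate-+ : ∀ l φ ψ p → dilate l (λ q → φ q ℕ.+ ψ q) p ≡ dilate l φ p ℕ.+ dilate l ψ p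
dilate-+ l φ ψ p = sum-map-+ (λ q → φ (p ℕ.* q)) (λ q → ψ (p ℕ.* q)) l

dilate-1∷ : ∀ l φ p → dilate (1 ∷ l) φ p ≡ φ p ℕ.+ dilate l φ p
dilate-1∷ l φ p = cong (λ q → φ q ℕ.+ dilate l φ p) (ℕ.*-identityʳ p)

fold-dilate-cong : ∀ l {φ ψ} → φ ≗ ψ → ∀ j → fold φ (dilate l) j ≗ fold ψ (dilate l) j
fold-dilate-cong l φ≗ψ zero    = φ≗ψ
fold-dilate-cong l φ≗ψ (suc j) = dilate-cong l (fold-dilate-cong l φ≗ψ j)

fold-dilate-+ : ∀ l φ ψ j p →
  fold (λ q → φ q ℕ.+ ψ q) (dilate l) j p ≡ fold φ (dilate l) j p ℕ.+ fold ψ (dilate l) j p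
fold-dilate-+ l φ ψ zero    p = refl
fold-dilate-+ l φ ψ (suc j) p = trans (dilate-cong l (fold-dilate-+ l φ ψ j) p)
  (dilate-+ l (fold φ (dilate l) j) (fold ψ (dilate l) j) p)

fold-comm : ∀ {A : Set} (s : A → A) z j → fold (s z) s j ≡ s (fold z s j)
fold-comm s z zero    = refl
fold-comm s z (suc j) = cong s (fold-comm s z j)

-- The number of tuples with product n whose first j entries lie in l and whose
-- last i entries lie in 1 ∷ l, written with iterated dilation operators.
mixedCount : List ℕ → (n j i : ℕ) → ℕ
mixedCount l n j i = fold (fold (point n) (dilate (1 ∷ l)) i) (dilate l) j 1

-- The first of the entries from 1 ∷ l is either 1 or an entry from l.
mixedCount-suc : ∀ l n j i →
  mixedCount l n j (suc i) ≡ mixedCount l n j i ℕ.+ mixedCount l n (suc j) i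
mixedCount-suc l n j i = begin
  fold (dilate (1 ∷ l) φ) (dilate l) j 1
    ≡⟨ fold-dilate-cong l (dilate-1∷ l φ) j 1 ⟩
  fold (λ p → φ p ℕ.+ dilate l φ p) (dilate l) j 1
    ≡⟨ fold-dilate-+ l φ (dilate l φ) j 1 ⟩
  fold φ (dilate l) j 1 ℕ.+ fold (dilate l φ) (dilate l) j 1
    ≡⟨ cong (λ ψ → fold φ (dilate l) j 1 ℕ.+ ψ 1) (fold-comm (dilate l) φ j) ⟩
  fold φ (dilate l) j 1 ℕ.+ dilate l (fold φ (dilate l) j) 1 ∎
  where
  open ≡-Reasoning
  φ = fold (point n) (dilate (1 ∷ l)) i

length-filter-map : ∀ {p} {A B : Set} {P : Pred B p} (P? : Decidable P) (g : A → B) xs →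
  length (filter P? (map g xs)) ≡ length (filter (P? ∘ g) xs)
length-filter-map P? g []       = refl
length-filter-map P? g (x ∷ xs) with P? (g x)
... | yes _ = cong suc (length-filter-map P? g xs)
... | no  _ = length-filter-map P? g xs

length-filter-cartesianProductWith : ∀ {p} {A B E : Set} {P : Pred E p} (P? : Decidable P)
  (g : A → B → E) xs ys →
  length (filter P? (cartesianProductWith g xs ys)) ≡
  sum (map (λ x → length (filter (P? ∘ g x) ys)) xs)
length-filter-cartesianProductWith P? g []       ys = refl
length-filter-cartesianProductWith P? g (x ∷ xs) ys = begin
  length (filter P? (map (g x) ys ++ rest))
    ≡⟨ cong length (filter-++ P? (map (g x) ys) rest) ⟩
  length (filter P? (map (g x) ys) ++ filter P? rest)
    ≡⟨ length-++ (filter P? (map (g x) ys)) ⟩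
  length (filter P? (map (g x) ys)) ℕ.+ length (filter P? rest)
    ≡⟨ cong₂ ℕ._+_ (length-filter-map P? (g x) ys)
         (length-filter-cartesianProductWith P? g xs ys) ⟩
  sum (map (λ x → length (filter (P? ∘ g x) ys)) (x ∷ xs)) ∎
  where
  open ≡-Reasoning
  rest = cartesianProductWith g xs ys

-- The factor p is the product of the entries already chosen, so that removing
-- the first entry of the tuple multiplies p by it.
count-tuples : ∀ l n k p →
  length (filter (λ v → p ℕ.* foldr′ ℕ._*_ 1 v ℕ.≟ n) (tuples l k)) ≡ fold (point n) (dilate l) k p
count-tuples l n zero p rewrite ℕ.*-identityʳ p with p ℕ.≡ᵇ n
... | true  = refl
... | false = refl
count-tuples l n (suc k) p = trans
  (length-filter-cartesianProductWith (λ v → p ℕ.* foldr′ ℕ._*_ 1 v ℕ.≟ n) _∷_ l (tuples l k))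
  (cong sum (map-cong (λ q → trans
    (cong length (filter-≐ _ (λ v → p ℕ.* q ℕ.* foldr′ ℕ._*_ 1 v ℕ.≟ n)
      ((λ {v} → trans (ℕ.*-assoc p q (foldr′ ℕ._*_ 1 v))) ,
       (λ {v} → trans (sym (ℕ.*-assoc p q (foldr′ ℕ._*_ 1 v)))))
      (tuples l k)))
    (count-tuples l n k (p ℕ.* q))) l))

factorizations≡ : ∀ m k n → factorizations m k n ≡ fold (point n) (dilate [ m ⋯ n ]) k 1
factorizations≡ m k n = trans
  (cong length (filter-≐ _ (λ v → 1 ℕ.* foldr′ ℕ._*_ 1 v ℕ.≟ n)
    ((λ {v} → trans (ℕ.*-identityˡ (foldr′ ℕ._*_ 1 v))) ,
     (λ {v} → trans (sym (ℕ.*-identityˡ (foldr′ ℕ._*_ 1 v)))))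
    (tuples [ m ⋯ n ] k)))
  (count-tuples [ m ⋯ n ] n k 1)

-- The sum over 1 ≤ n ≤ N of the number of tuples with product n, j entries ≥ 2
-- and i further entries ≥ 1.
mixedTotal : (N j i : ℕ) → ℕ
mixedTotal N j i = sum (map (λ n → mixedCount [ 2 ⋯ n ] n j i) [ 1 ⋯ N ])

mixedTotal-suc : ∀ N j i → mixedTotal N j (suc i) ≡ mixedTotal N j i ℕ.+ mixedTotal N (suc j) i
mixedTotal-suc N j i = trans (cong sum (map-cong (λ n → mixedCount-suc [ 2 ⋯ n ] n j i) [ 1 ⋯ N ]))
  (sum-map-+ (λ n → mixedCount [ 2 ⋯ n ] n j i) (λ n → mixedCount [ 2 ⋯ n ] n (suc j) i) [ 1 ⋯ N ])

sum-f : ∀ N k → sum (map (f k) [ 1 ⋯ N ]) ≡ mixedTotal N k 0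
sum-f N k = cong sum (map-cong (λ n → factorizations≡ 2 k n) [ 1 ⋯ N ])

-- For n ≥ 1 the list [ 1 ⋯ n ] unfolds to 1 ∷ [ 2 ⋯ n ].
sum-d : ∀ N i → sum (map (d i) [ 1 ⋯ N ]) ≡ mixedTotal N 0 i
sum-d N i = cong sum (map-cong-local
  (All.applyUpTo⁺₂ _ N (λ m → factorizations≡ 1 i (suc m))))

-- Only the empty tuple is counted, and only for n = 1.
sum-d0≤1 : ∀ N → sum (map (d 0) [ 1 ⋯ N ]) ℕ.≤ 1
sum-d0≤1 zero    = ℕ.z≤n
sum-d0≤1 (suc N) = ℕ.≤-reflexive (cong suc (vanishes (λ m → m) N))
  where
  vanishes : ∀ (h : ℕ → ℕ) m → sum (map (d 0) (applyUpTo (λ r → suc (suc (h r))) m)) ≡ 0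
  vanishes h zero    = refl
  vanishes h (suc m) = vanishes (h ∘ suc) m

-- Finite sums of rational numbers

psum-cong : ∀ {s t} → s ≗ t → psum s ≗ psum t
psum-cong s≗t zero    = refl
psum-cong s≗t (suc n) = cong₂ ℚ._+_ (psum-cong s≗t n) (s≗t n)

psum-+ : ∀ s t n → psum (λ i → s i ℚ.+ t i) n ≡ psum s n ℚ.+ psum t n
psum-+ s t zero    = refl
psum-+ s t (suc n) = trans (cong (ℚ._+ (s n ℚ.+ t n)) (psum-+ s t n))
  (solve 4 (λ a b c d → a :+ b :+ (c :+ d) := a :+ c :+ (b :+ d)) refl
    (psum s n) (psum t n) (s n) (t n))
  where open +-*-Solver

psum-*ˡ : ∀ c t n → psum (λ i → c ℚ.* t i) n ≡ c ℚ.* psum t n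
psum-*ˡ c t zero    = sym (ℚ.*-zeroʳ c)
psum-*ˡ c t (suc n) = trans (cong (ℚ._+ c ℚ.* t n) (psum-*ˡ c t n))
  (sym (ℚ.*-distribˡ-+ c (psum t n) (t n)))

psum-*ʳ : ∀ c t n → psum (λ i → t i ℚ.* c) n ≡ psum t n ℚ.* c
psum-*ʳ c t n = trans (psum-cong (λ i → ℚ.*-comm (t i) c) n)
  (trans (psum-*ˡ c t n) (ℚ.*-comm c (psum t n)))

psum-minus : ∀ s t n → psum (λ i → s i ℚ.- t i) n ≡ psum s n ℚ.- psum t n
psum-minus s t zero    = refl
psum-minus s t (suc n) = trans (cong (ℚ._+ (s n ℚ.- t n)) (psum-minus s t n))
  (solve 4 (λ a b c d → a :- b :+ (c :- d) := a :+ c :- (b :+ d)) refl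
    (psum s n) (psum t n) (s n) (t n))
  where open +-*-Solver

psum-suc : ∀ t n → psum t (suc n) ≡ t 0 ℚ.+ psum (t ∘ suc) n
psum-suc t zero    = ℚ.+-comm 0ℚ (t 0)
psum-suc t (suc n) = trans (cong (ℚ._+ t (suc n)) (psum-suc t n))
  (ℚ.+-assoc (t 0) (psum (t ∘ suc) n) (t (suc n)))

-- Exchange of summation over the triangle 0 ≤ j < i ≤ k, with i = suc j + r.
psum-triangle : ∀ (t : ℕ → ℕ → ℚ) k →
  psum (λ i → psum (t i) i) (suc k) ≡
  psum (λ j → psum (λ r → t (suc j ℕ.+ r) j) (k ∸ j)) k
psum-triangle t zero    = refl
psum-triangle t (suc k) = begin
  psum (λ i → psum (t i) i) (suc (suc k))
    ≡⟨ trans (psum-suc (λ i → psum (t i) i) (suc k)) (ℚ.+-identityˡ _) ⟩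
  psum (λ i → psum (t (suc i)) (suc i)) (suc k)
    ≡⟨ psum-cong (λ i → psum-suc (t (suc i)) i) (suc k) ⟩
  psum (λ i → t (suc i) 0 ℚ.+ psum (t′ i) i) (suc k)
    ≡⟨ psum-+ (λ i → t (suc i) 0) (λ i → psum (t′ i) i) (suc k) ⟩
  psum (λ i → t (suc i) 0) (suc k) ℚ.+ psum (λ i → psum (t′ i) i) (suc k)
    ≡⟨ cong (psum (λ i → t (suc i) 0) (suc k) ℚ.+_) (psum-triangle t′ k) ⟩
  psum (λ i → t (suc i) 0) (suc k) ℚ.+ psum (λ j → psum (λ r → t′ (suc j ℕ.+ r) j) (k ∸ j)) k
    ≡⟨ psum-suc (λ j → psum (λ r → t (suc j ℕ.+ r) j) (suc k ∸ j)) k ⟨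
  psum (λ j → psum (λ r → t (suc j ℕ.+ r) j) (suc k ∸ j)) (suc k) ∎
  where
  open ≡-Reasoning
  t′ : ℕ → ℕ → ℚ
  t′ i j = t (suc i) (suc j)

-- Binomial inversion

-- (-1)^(k-i) C(k,i); it vanishes for i > k, where k ∸ i is truncated.
signedBinomial : (k i : ℕ) → ℤ
signedBinomial k i = -1ℤ ℤ.^ (k ∸ i) ℤ.* ℤ.+ (k C i)

signedBinomial-zero : ∀ k → signedBinomial (suc k) 0 ≡ ℤ.- signedBinomial k 0
signedBinomial-zero k = trans (ℤ.*-assoc -1ℤ (-1ℤ ℤ.^ k) (ℤ.+ 1)) (ℤ.-1*i≡-i _)

-- Pascal's rule with alternating signs.
signedBinomial-suc : ∀ k i →
  signedBinomial (suc k) (suc i) ≡ signedBinomial k i ℤ.- signedBinomial k (suc i)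
signedBinomial-suc k i with ℕ.≤-<-connex k i
... | inj₁ k≤i = begin
  u ℤ.* ℤ.+ (suc k C suc i)
    ≡⟨ cong (λ c → u ℤ.* ℤ.+ c) (nCk+nC[k+1]≡[n+1]C[k+1] k i) ⟨
  u ℤ.* ℤ.+ (k C i ℕ.+ k C suc i)
    ≡⟨ cong (λ c → u ℤ.* ℤ.+ (k C i ℕ.+ c)) kC≡0 ⟩
  u ℤ.* ℤ.+ (k C i ℕ.+ 0)
    ≡⟨ cong (λ c → u ℤ.* ℤ.+ c) (ℕ.+-identityʳ (k C i)) ⟩
  u ℤ.* ℤ.+ (k C i)
    ≡⟨ ℤ.+-identityʳ _ ⟨
  u ℤ.* ℤ.+ (k C i) ℤ.- ℤ.+ 0
    ≡⟨ cong (λ z → u ℤ.* ℤ.+ (k C i) ℤ.- z) (ℤ.*-zeroʳ w) ⟨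
  u ℤ.* ℤ.+ (k C i) ℤ.- w ℤ.* ℤ.+ 0
    ≡⟨ cong (λ c → u ℤ.* ℤ.+ (k C i) ℤ.- w ℤ.* ℤ.+ c) kC≡0 ⟨
  signedBinomial k i ℤ.- signedBinomial k (suc i) ∎
  where
  open ≡-Reasoning
  u = -1ℤ ℤ.^ (k ∸ i)
  w = -1ℤ ℤ.^ (k ∸ suc i)
  kC≡0 : k C suc i ≡ 0
  kC≡0 = k>n⇒nCk≡0 (ℕ.s≤s k≤i)
... | inj₂ i<k = begin
  -1ℤ ℤ.^ (k ∸ i) ℤ.* ℤ.+ (suc k C suc i)
    ≡⟨ cong₂ (λ e c → -1ℤ ℤ.^ e ℤ.* ℤ.+ c) (ℕ.+-∸-assoc 1 i<k) (sym (nCk+nC[k+1]≡[n+1]C[k+1] k i)) ⟩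
  -1ℤ ℤ.* w ℤ.* (ℤ.+ (k C i) ℤ.+ ℤ.+ (k C suc i))
    ≡⟨ solve 3 (λ w a b → con -1ℤ :* w :* (a :+ b) := con -1ℤ :* w :* a :- w :* b) refl
         w (ℤ.+ (k C i)) (ℤ.+ (k C suc i)) ⟩
  -1ℤ ℤ.* w ℤ.* ℤ.+ (k C i) ℤ.- w ℤ.* ℤ.+ (k C suc i)
    ≡⟨ cong (λ e → -1ℤ ℤ.^ e ℤ.* ℤ.+ (k C i) ℤ.- w ℤ.* ℤ.+ (k C suc i)) (ℕ.+-∸-assoc 1 i<k) ⟨
  signedBinomial k i ℤ.- signedBinomial k (suc i) ∎
  where
  open ≡-Reasoning
  open Data.Integer.Solver.+-*-Solver
  w = -1ℤ ℤ.^ (k ∸ suc i)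

-- An integer as a rational number.
fromℤℚ : ℤ → ℚ
fromℤℚ i = i ℚ./ 1

toℚᵘ-fromℤ : ∀ i → ℚ.toℚᵘ (fromℤℚ i) ℚᵘ.≃ ℚᵘ.mkℚᵘ i 0
toℚᵘ-fromℤ i = ℚ.toℚᵘ-fromℚᵘ (ℚᵘ.mkℚᵘ i 0)

fromℤℚ-minus : ∀ i j → fromℤℚ (i ℤ.- j) ≡ fromℤℚ i ℚ.- fromℤℚ j
fromℤℚ-minus i j = ℚ.toℚᵘ-injective (ℚᵘ.≃-trans (toℚᵘ-fromℤ (i ℤ.- j)) (ℚᵘ.≃-sym
  (ℚᵘ.≃-trans (ℚ.toℚᵘ-homo-+ (fromℤℚ i) (ℚ.- fromℤℚ j))
    (ℚᵘ.≃-trans (ℚᵘ.+-cong (toℚᵘ-fromℤ i)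
        (ℚᵘ.≃-trans (ℚ.toℚᵘ-homo‿- (fromℤℚ j)) (ℚᵘ.-‿cong (toℚᵘ-fromℤ j))))
      (ℚᵘ.*≡* (cong (ℤ._* ℤ.+ 1) (cong₂ ℤ._+_ (ℤ.*-identityʳ i) (ℤ.*-identityʳ (ℤ.- j)))))))))

-- The rational number (-1)^(k-i) C(k,i).
coeff : (k i : ℕ) → ℚ
coeff k i = fromℤℚ (signedBinomial k i)

coeff-zero : ∀ k → coeff (suc k) 0 ≡ ℚ.- coeff k 0
coeff-zero k = trans (cong fromℤℚ (trans (signedBinomial-zero k) (sym (ℤ.+-identityˡ _))))
  (trans (fromℤℚ-minus (ℤ.+ 0) (signedBinomial k 0)) (ℚ.+-identityˡ _))

coeff-suc : ∀ k i → coeff (suc k) (suc i) ≡ coeff k i ℚ.- coeff k (suc i)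
coeff-suc k i = trans (cong fromℤℚ (signedBinomial-suc k i))
  (fromℤℚ-minus (signedBinomial k i) (signedBinomial k (suc i)))

coeff-outside : ∀ k → coeff k (suc k) ≡ 0ℚ
coeff-outside k = cong fromℤℚ
  (trans (cong (λ c → -1ℤ ℤ.^ (k ∸ suc k) ℤ.* ℤ.+ c) (k>n⇒nCk≡0 (ℕ.n<1+n k)))
    (ℤ.*-zeroʳ (-1ℤ ℤ.^ (k ∸ suc k))))

-- The hypothesis says that g (j + 1) is the difference i ↦ g j (i + 1) - g j i,
-- so g k 0 is the k-th difference of g 0 at 0.
binomial-inversion : ∀ (g : ℕ → ℕ → ℚ) → (∀ j i → g j (suc i) ≡ g j i ℚ.+ g (suc j) i) →
  ∀ k → g k 0 ≡ psum (λ i → coeff k i ℚ.* g 0 i) (suc k)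
binomial-inversion g rec zero    = solve 1 (λ x → x := con 0ℚ :+ con 1ℚ :* x) refl (g 0 0)
  where open +-*-Solver
binomial-inversion g rec (suc k) = begin
  g (suc k) 0
    ≡⟨ binomial-inversion (λ j → g (suc j)) (λ j → rec (suc j)) k ⟩
  psum (λ i → c i ℚ.* g 1 i) (suc k)
    ≡⟨ psum-cong (λ i → step (c i) (rec 0 i)) (suc k) ⟩
  psum (λ i → c i ℚ.* g 0 (suc i) ℚ.- c i ℚ.* g 0 i) (suc k)
    ≡⟨ psum-minus (λ i → c i ℚ.* g 0 (suc i)) (λ i → c i ℚ.* g 0 i) (suc k) ⟩
  A ℚ.- psum (λ i → c i ℚ.* g 0 i) (suc k)
    ≡⟨ cong (λ z → A ℚ.- z) shift ⟩
  A ℚ.- (c 0 ℚ.* g 0 0 ℚ.+ B)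
    ≡⟨ solve 4 (λ a c g b → a :- (c :* g :+ b) := :- c :* g :+ (a :- b)) refl A (c 0) (g 0 0) B ⟩
  ℚ.- c 0 ℚ.* g 0 0 ℚ.+ (A ℚ.- B)
    ≡⟨ cong₂ (λ y z → y ℚ.* g 0 0 ℚ.+ z) (coeff-zero k)
         (psum-minus (λ i → c i ℚ.* g 0 (suc i)) (λ i → c (suc i) ℚ.* g 0 (suc i)) (suc k)) ⟨
  c′ 0 ℚ.* g 0 0 ℚ.+ psum (λ i → c i ℚ.* g 0 (suc i) ℚ.- c (suc i) ℚ.* g 0 (suc i)) (suc k)
    ≡⟨ cong (c′ 0 ℚ.* g 0 0 ℚ.+_) (psum-cong pascal (suc k)) ⟨
  c′ 0 ℚ.* g 0 0 ℚ.+ psum (λ i → c′ (suc i) ℚ.* g 0 (suc i)) (suc k)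
    ≡⟨ psum-suc (λ i → c′ i ℚ.* g 0 i) (suc k) ⟨
  psum (λ i → c′ i ℚ.* g 0 i) (suc (suc k)) ∎
  where
  open ≡-Reasoning
  open +-*-Solver
  c c′ : ℕ → ℚ
  c  = coeff k
  c′ = coeff (suc k)
  A B : ℚ
  A = psum (λ i → c i ℚ.* g 0 (suc i)) (suc k)
  B = psum (λ i → c (suc i) ℚ.* g 0 (suc i)) (suc k)
  step : ∀ c {x y z} → x ≡ y ℚ.+ z → c ℚ.* z ≡ c ℚ.* x ℚ.- c ℚ.* y
  step c {y = y} {z} refl = solve 3 (λ c y z → c :* z := c :* (y :+ z) :- c :* y) refl c y z
  pascal : ∀ i → c′ (suc i) ℚ.* g 0 (suc i) ≡ c i ℚ.* g 0 (suc i) ℚ.- c (suc i) ℚ.* g 0 (suc i)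
  pascal i = trans (cong (ℚ._* g 0 (suc i)) (coeff-suc k i))
    (solve 3 (λ a b x → (a :- b) :* x := a :* x :- b :* x) refl (c i) (c (suc i)) (g 0 (suc i)))
  shift : psum (λ i → c i ℚ.* g 0 i) (suc k) ≡ c 0 ℚ.* g 0 0 ℚ.+ B
  shift = begin
    psum (λ i → c i ℚ.* g 0 i) (suc k)
      ≡⟨ solve 2 (λ s x → s := s :+ con 0ℚ :* x) refl _ (g 0 (suc k)) ⟩
    psum (λ i → c i ℚ.* g 0 i) (suc k) ℚ.+ 0ℚ ℚ.* g 0 (suc k)
      ≡⟨ cong (λ z → psum (λ i → c i ℚ.* g 0 i) (suc k) ℚ.+ z ℚ.* g 0 (suc k)) (coeff-outside k) ⟨
    psum (λ i → c i ℚ.* g 0 i) (suc (suc k))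
      ≡⟨ psum-suc (λ i → c i ℚ.* g 0 i) (suc k) ⟩
    c 0 ℚ.* g 0 0 ℚ.+ B ∎

-- Order of rational partial sums

psum-mono : ∀ {s t} → (∀ i → s i ℚ.≤ t i) → ∀ n → psum s n ℚ.≤ psum t n
psum-mono s≤t zero    = ℚ.≤-refl
psum-mono s≤t (suc n) = ℚ.+-mono-≤ (psum-mono s≤t n) (s≤t n)

0≤psum : ∀ {t} → (∀ i → 0ℚ ℚ.≤ t i) → ∀ n → 0ℚ ℚ.≤ psum t n
0≤psum 0≤t zero    = ℚ.≤-refl
0≤psum 0≤t (suc n) = 0≤+ (0≤psum 0≤t n) (0≤t n)

p≤p+ : ∀ p {e} → 0ℚ ℚ.≤ e → p ℚ.≤ p ℚ.+ e
p≤p+ p {e} 0≤e = subst (ℚ._≤ p ℚ.+ e) (ℚ.+-identityʳ p) (ℚ.+-monoʳ-≤ p 0≤e)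

-- Order of real numbers

-- The order holds if it holds, without any slack, between late approximations.
seqwise-≤ : ∀ {x y} → Eventually (λ n → seq x n ℚ.≤ seq y n) → x ≤ y
seqwise-≤ (N , x≤y) = mk≤ λ e 0<e → N , λ n N≤n →
  ℚ.≤-trans (x≤y n N≤n) (p≤p+ _ (ℚ.<⇒≤ 0<e))

seqwise-≃ : ∀ {x y} → seq x ≗ seq y → x ≃ y
seqwise-≃ {x} {y} x≗y = mk≃ λ e 0<e → 0 , λ n _ →
  subst (ℚ._≤ e) (sym (cong ℚ.∣_∣ (trans (cong (ℚ._- seq y n) (x≗y n)) (ℚ.+-inverseʳ (seq y n)))))
    (ℚ.<⇒≤ 0<e)

≤-transitive : ∀ {x y z} → x ≤ y → y ≤ z → x ≤ z
≤-transitive {x} {y} {z} x≤y y≤z = mk≤ λ e 0<e →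
  let (N₁ , h₁) = eventually-≤ x≤y (e ℚ.* ½) (0<half 0<e)
      (N₂ , h₂) = eventually-≤ y≤z (e ℚ.* ½) (0<half 0<e)
  in N₁ ℕ.⊔ N₂ , λ n N≤n → begin
  seq x n                                ≤⟨ h₁ n (ℕ.m⊔n≤o⇒m≤o N₁ N₂ N≤n) ⟩
  seq y n ℚ.+ e ℚ.* ½                    ≤⟨ ℚ.+-monoˡ-≤ (e ℚ.* ½) (h₂ n (ℕ.m⊔n≤o⇒n≤o N₁ N₂ N≤n)) ⟩
  seq z n ℚ.+ e ℚ.* ½ ℚ.+ e ℚ.* ½        ≡⟨ ℚ.+-assoc (seq z n) (e ℚ.* ½) (e ℚ.* ½) ⟩
  seq z n ℚ.+ (e ℚ.* ½ ℚ.+ e ℚ.* ½)      ≡⟨ cong (seq z n ℚ.+_) (halve e) ⟩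
  seq z n ℚ.+ e                          ∎
  where open ℚ.≤-Reasoning

-- Calculus of O-bounds

-- The functions are required to agree approximation by approximation, not
-- merely up to the equality of real numbers.
=O-cong : ∀ {g h k} → (∀ x → seq (g x) ≗ seq (h x)) → h =O k → g =O k
=O-cong {g} {h} {k} g≗h (K , X , bound) = K , X , λ x X≤x → mk≤ λ e 0<e →
  let (N , le) = eventually-≤ (bound x X≤x) e 0<e in
  N , λ n N≤n → subst (λ q → ℚ.∣ q ∣ ℚ.≤ seq K n ℚ.* seq (k x) n ℚ.+ e) (sym (g≗h x n)) (le n N≤n)

=O-zero : ∀ {k} → (λ _ → 0ℝ) =O k
=O-zero {k} = 0ℝ , 0ℝ , λ x _ →
  seqwise-≤ (0 , λ n _ → ℚ.≤-reflexive (sym (ℚ.*-zeroˡ (seq (k x) n))))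

-- A threshold above both X and X′ is ∣ X ∣ + ∣ X′ ∣, which needs no maximum of
-- real numbers.
=O-+ : ∀ {g h k} → g =O k → h =O k → (λ x → g x + h x) =O k
=O-+ {g} {h} {k} (K , X , gk) (K′ , X′ , hk) = K + K′ , ∣ X ∣ + ∣ X′ ∣ , λ x large → mk≤ λ e 0<e →
  let X≤  = seqwise-≤ (0 , λ n _ → ℚ.≤-trans (p≤∣p∣ (seq X n)) (p≤p+ _ (ℚ.0≤∣p∣ (seq X′ n))))
      X′≤ = seqwise-≤ (0 , λ n _ → ℚ.≤-trans (p≤∣p∣ (seq X′ n))
              (subst (ℚ.∣ seq X′ n ∣ ℚ.≤_) (ℚ.+-comm ℚ.∣ seq X′ n ∣ ℚ.∣ seq X n ∣)
                (p≤p+ _ (ℚ.0≤∣p∣ (seq X n)))))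
      (N₁ , h₁) = eventually-≤ (gk x (≤-transitive {X} {∣ X ∣ + ∣ X′ ∣} {val x} X≤ large))
                    (e ℚ.* ½) (0<half 0<e)
      (N₂ , h₂) = eventually-≤ (hk x (≤-transitive {X′} {∣ X ∣ + ∣ X′ ∣} {val x} X′≤ large))
                    (e ℚ.* ½) (0<half 0<e)
  in N₁ ℕ.⊔ N₂ , λ n N≤n → combine e (seq (g x) n) (seq (h x) n) (seq K n) (seq K′ n) (seq (k x) n)
    (h₁ n (ℕ.m⊔n≤o⇒m≤o N₁ N₂ N≤n)) (h₂ n (ℕ.m⊔n≤o⇒n≤o N₁ N₂ N≤n))
  where
  combine : ∀ e u v c c′ w → ℚ.∣ u ∣ ℚ.≤ c ℚ.* w ℚ.+ e ℚ.* ½ → ℚ.∣ v ∣ ℚ.≤ c′ ℚ.* w ℚ.+ e ℚ.* ½ →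
    ℚ.∣ u ℚ.+ v ∣ ℚ.≤ (c ℚ.+ c′) ℚ.* w ℚ.+ e
  combine e u v c c′ w hu hv = begin
    ℚ.∣ u ℚ.+ v ∣                                       ≤⟨ ℚ.∣p+q∣≤∣p∣+∣q∣ u v ⟩
    ℚ.∣ u ∣ ℚ.+ ℚ.∣ v ∣                                 ≤⟨ ℚ.+-mono-≤ hu hv ⟩
    c ℚ.* w ℚ.+ e ℚ.* ½ ℚ.+ (c′ ℚ.* w ℚ.+ e ℚ.* ½)
      ≡⟨ solve 4 (λ c d w z → c :* w :+ z :+ (d :* w :+ z) := (c :+ d) :* w :+ (z :+ z)) refl
           c c′ w (e ℚ.* ½) ⟩
    (c ℚ.+ c′) ℚ.* w ℚ.+ (e ℚ.* ½ ℚ.+ e ℚ.* ½)          ≡⟨ cong ((c ℚ.+ c′) ℚ.* w ℚ.+_) (halve e) ⟩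
    (c ℚ.+ c′) ℚ.* w ℚ.+ e                              ∎
    where
    open ℚ.≤-Reasoning
    open +-*-Solver

=O-scale : ∀ q {g k} → g =O k → (λ x → fromℚ q * g x) =O k
=O-scale q {g} {k} (K , X , gk) = fromℚ ℚ.∣ q ∣ * K , X , λ x X≤x → mk≤ λ e 0<e →
  let (M , q≤M)      = archimedean ℚ.∣ q ∣
      (δ , 0<δ , Mδ) = shrink (0<fromℕℚ-suc M) 0<e
      (N , le)       = eventually-≤ (gk x X≤x) δ 0<δ
  in N , λ n N≤n → scale e M δ (seq (g x) n) (seq K n) (seq (k x) n) q≤M (ℚ.<⇒≤ 0<δ) Mδ (le n N≤n)
  where
  scale : ∀ e M δ u c w → ℚ.∣ q ∣ ℚ.≤ fromℕℚ M → 0ℚ ℚ.≤ δ → fromℕℚ (suc M) ℚ.* δ ≡ e →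
    ℚ.∣ u ∣ ℚ.≤ c ℚ.* w ℚ.+ δ → ℚ.∣ q ℚ.* u ∣ ℚ.≤ ℚ.∣ q ∣ ℚ.* c ℚ.* w ℚ.+ e
  scale e M δ u c w q≤M 0≤δ Mδ≡e le = begin
    ℚ.∣ q ℚ.* u ∣                                 ≡⟨ ℚ.∣p*q∣≡∣p∣*∣q∣ q u ⟩
    ℚ.∣ q ∣ ℚ.* ℚ.∣ u ∣                           ≤⟨ *-monoˡ₀ (ℚ.0≤∣p∣ q) le ⟩
    ℚ.∣ q ∣ ℚ.* (c ℚ.* w ℚ.+ δ)
      ≡⟨ solve 4 (λ q c w d → q :* (c :* w :+ d) := q :* c :* w :+ q :* d) refl ℚ.∣ q ∣ c w δ ⟩
    ℚ.∣ q ∣ ℚ.* c ℚ.* w ℚ.+ ℚ.∣ q ∣ ℚ.* δ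
      ≤⟨ ℚ.+-monoʳ-≤ (ℚ.∣ q ∣ ℚ.* c ℚ.* w)
           (*-monoʳ₀ 0≤δ (ℚ.≤-trans q≤M (fromℕℚ-mono (ℕ.n≤1+n M)))) ⟩
    ℚ.∣ q ∣ ℚ.* c ℚ.* w ℚ.+ fromℕℚ (suc M) ℚ.* δ  ≡⟨ cong (ℚ.∣ q ∣ ℚ.* c ℚ.* w ℚ.+_) Mδ≡e ⟩
    ℚ.∣ q ∣ ℚ.* c ℚ.* w ℚ.+ e                     ∎
    where
    open ℚ.≤-Reasoning
    open +-*-Solver

=O-∑ : ∀ {k} (f : ℕ → ℝ≥1 → ℝ) {l} → All (λ i → f i =O k) l → (λ x → ∑[ i ∈ l ] f i x) =O k
=O-∑ {k} f []       = =O-cong {λ x → ∑[ i ∈ [] ] f i x} {λ _ → 0ℝ} {k} (λ _ _ → refl) (=O-zero {k})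
=O-∑ {k} f {i ∷ l} (p ∷ ps) =
  =O-cong {λ x → ∑[ j ∈ i ∷ l ] f j x} {λ x → f i x + ∑[ j ∈ l ] f j x} {k} (λ _ _ → refl)
    (=O-+ {f i} {λ x → ∑[ i ∈ l ] f i x} {k} p (=O-∑ {k} f {l} ps))

-- The constant K may be negative, so it is replaced by a natural number B with
-- ∣ K ∣ ≤ B.  The three hypotheses at the point x are used with slack δ, which
-- adds up to (3 B + 1) δ in the conclusion.
=O-mono : ∀ {g h k} → (∀ x → 0ℝ ≤ h x) → (∀ x → h x ≤ k x) → g =O h → g =O k
=O-mono {g} {h} {k} 0≤h h≤k (K , X , gh) =
  let (B , N₀ , K≤B) = bounded (cauchy K) in
  fromℕ B , X , λ x X≤x → mk≤ λ e 0<e →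
  let (δ , 0<δ , Bδ) = shrink (0<fromℕℚ-suc (3 ℕ.* B)) 0<e
      (N₁ , h₁)      = eventually-≤ (0≤h x) δ 0<δ
      (N₂ , h₂)      = eventually-≤ (h≤k x) δ 0<δ
      (N₃ , h₃)      = eventually-≤ (gh x X≤x) δ 0<δ
      N₀₁ = N₀ ℕ.⊔ N₁
      N₂₃ = N₂ ℕ.⊔ N₃
  in N₀₁ ℕ.⊔ N₂₃ , λ n N≤n →
    let N₀₁≤n = ℕ.m⊔n≤o⇒m≤o N₀₁ N₂₃ N≤n
        N₂₃≤n = ℕ.m⊔n≤o⇒n≤o N₀₁ N₂₃ N≤n
    in ℚ.≤-trans (h₃ n (ℕ.m⊔n≤o⇒n≤o N₂ N₃ N₂₃≤n))
      (enlarge e B δ (seq K n) (seq (h x) n) (seq (k x) n) (ℚ.<⇒≤ 0<δ) Bδ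
        (K≤B n (ℕ.m⊔n≤o⇒m≤o N₀ N₁ N₀₁≤n)) (h₁ n (ℕ.m⊔n≤o⇒n≤o N₀ N₁ N₀₁≤n))
        (h₂ n (ℕ.m⊔n≤o⇒m≤o N₂ N₃ N₂₃≤n)))
  where
  enlarge : ∀ e B δ c w v → 0ℚ ℚ.≤ δ → fromℕℚ (suc (3 ℕ.* B)) ℚ.* δ ≡ e →
    ℚ.∣ c ∣ ℚ.≤ fromℕℚ B → 0ℚ ℚ.≤ w ℚ.+ δ → w ℚ.≤ v ℚ.+ δ →
    c ℚ.* w ℚ.+ δ ℚ.≤ fromℕℚ B ℚ.* v ℚ.+ e
  enlarge e B δ c w v 0≤δ Bδ≡e ∣c∣≤B 0≤w+δ w≤v+δ = begin
    c ℚ.* w ℚ.+ δ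
      ≡⟨ solve 3 (λ c w d → c :* w :+ d := c :* (w :+ d) :+ :- c :* d :+ d) refl c w δ ⟩
    c ℚ.* (w ℚ.+ δ) ℚ.+ ℚ.- c ℚ.* δ ℚ.+ δ
      ≤⟨ ℚ.+-monoˡ-≤ δ (ℚ.+-mono-≤ (*-monoʳ₀ 0≤w+δ c≤B) (*-monoʳ₀ 0≤δ -c≤B)) ⟩
    L ℚ.* (w ℚ.+ δ) ℚ.+ L ℚ.* δ ℚ.+ δ
      ≤⟨ ℚ.+-monoˡ-≤ δ (ℚ.+-monoˡ-≤ (L ℚ.* δ) (*-monoˡ₀ (0≤fromℕℚ B) (ℚ.+-monoˡ-≤ δ w≤v+δ))) ⟩
    L ℚ.* (v ℚ.+ δ ℚ.+ δ) ℚ.+ L ℚ.* δ ℚ.+ δ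
      ≡⟨ solve 3 (λ b v d → b :* (v :+ d :+ d) :+ b :* d :+ d :=
                   b :* v :+ (con 1ℚ :+ con (fromℕℚ 3) :* b) :* d) refl L v δ ⟩
    L ℚ.* v ℚ.+ (1ℚ ℚ.+ fromℕℚ 3 ℚ.* L) ℚ.* δ
      ≡⟨ cong (λ z → L ℚ.* v ℚ.+ z ℚ.* δ)
           (trans (fromℕℚ-suc (3 ℕ.* B)) (cong (1ℚ ℚ.+_) (fromℕℚ-* 3 B))) ⟨
    L ℚ.* v ℚ.+ fromℕℚ (suc (3 ℕ.* B)) ℚ.* δ   ≡⟨ cong (L ℚ.* v ℚ.+_) Bδ≡e ⟩
    L ℚ.* v ℚ.+ e                              ∎
    where
    L = fromℕℚ B
    c≤B : c ℚ.≤ L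
    c≤B = ℚ.≤-trans (p≤∣p∣ c) ∣c∣≤B
    -c≤B : ℚ.- c ℚ.≤ L
    -c≤B = ℚ.≤-trans (p≤∣p∣ (ℚ.- c)) (subst (ℚ._≤ L) (sym (ℚ.∣-p∣≡∣p∣ c)) ∣c∣≤B)
    open ℚ.≤-Reasoning
    open +-*-Solver

-- Exponentials and powers

-- On nonnegative arguments the partial sums of the series are monotone term by
-- term.
exp-mono : ∀ {x y} → Eventually (λ n → 0ℚ ℚ.≤ seq x n × seq x n ℚ.≤ seq y n) → exp x ≤ exp y
exp-mono (N , h) = seqwise-≤ (N , λ n N≤n → psum-mono (λ m →
  *-monoˡ₀ (0≤expCoeff m) (^-mono (proj₁ (h n N≤n)) (proj₂ (h n N≤n)) m)) n)

-- The constant term of the series is 1; the empty partial sum, of index 0, is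
-- excluded by taking n > N.
1≤exp : ∀ {x} → Eventually (λ n → 0ℚ ℚ.≤ seq x n) → 1ℝ ≤ exp x
1≤exp {x} (N , 0≤x) = seqwise-≤ (suc N , bound)
  where
  bound : ∀ n → suc N ≤ℕ n → 1ℚ ℚ.≤ seq (exp x) n
  bound n@(suc n′) N<n = subst (1ℚ ℚ.≤_)
    (sym (psum-suc (λ m → expCoeff m ℚ.* seq x n ^ℚ m) n′))
    (p≤p+ 1ℚ (0≤psum (λ m → 0≤* (0≤expCoeff (suc m)) (0≤^ (0≤x n (ℕ.<⇒≤ N<n)) (suc m))) n′))

-- Every approximation of log x is a sum of nonnegative terms.
0≤log : ∀ x n → 0ℚ ℚ.≤ seq (log x) n
0≤log x n = 0≤psum (λ m → 0≤* (0≤logCoeff m) (0≤^ (0≤logArg (seq (val x) n)) m)) n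

eventually-0≤ : ∀ {ε} → 0ℝ < ε → Eventually (λ n → 0ℚ ℚ.≤ seq ε n)
eventually-0≤ (mk< gap 0<gap (N , h)) = N , λ n N≤n →
  ℚ.≤-trans (ℚ.≤-trans (ℚ.<⇒≤ 0<gap) (ℚ.≤-reflexive (sym (ℚ.+-identityˡ gap)))) (h n N≤n)

0≤exponent : ∀ {p} ε → 0ℚ ℚ.≤ p → 0ℝ < ε → ∀ x →
  Eventually (λ n → 0ℚ ℚ.≤ seq ((fromℚ p + ε) * log x) n)
0≤exponent {p} ε 0≤p 0<ε x = let (N , 0≤ε) = eventually-0≤ {ε} 0<ε in
  N , λ n N≤n → 0≤* {p ℚ.+ seq ε n} {seq (log x) n} (0≤+ {p} {seq ε n} 0≤p (0≤ε n N≤n)) (0≤log x n)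

1≤^ℝ : ∀ {p} ε → 0ℚ ℚ.≤ p → 0ℝ < ε → ∀ x → 1ℝ ≤ x ^ℝ (fromℚ p + ε)
1≤^ℝ {p} ε 0≤p 0<ε x = 1≤exp {(fromℚ p + ε) * log x} (0≤exponent ε 0≤p 0<ε x)

^ℝ-mono : ∀ {p q} ε → 0ℚ ℚ.≤ p → p ℚ.≤ q → 0ℝ < ε → ∀ x →
  x ^ℝ (fromℚ p + ε) ≤ x ^ℝ (fromℚ q + ε)
^ℝ-mono {p} {q} ε 0≤p p≤q 0<ε x = let (N , 0≤s) = 0≤exponent ε 0≤p 0<ε x in
  exp-mono {(fromℚ p + ε) * log x} {(fromℚ q + ε) * log x} (N , λ n N≤n → 0≤s n N≤n ,
    *-monoʳ₀ {seq (log x) n} {p ℚ.+ seq ε n} {q ℚ.+ seq ε n} (0≤log x n)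
      (ℚ.+-monoˡ-≤ (seq ε n) p≤q))

-- The exponents

0≤α : ∀ i → 0ℚ ℚ.≤ α i
0≤α zero    = ℚ.≤-refl
0≤α (suc i) = ℚ.nonNegative⁻¹ (α (suc i)) {{ℚ.normalize-nonNeg i (suc i)}}

base≤foldr-⊔ : ∀ b l → b ℚ.≤ foldr ℚ._⊔_ b l
base≤foldr-⊔ b []      = ℚ.≤-refl
base≤foldr-⊔ b (q ∷ l) = ℚ.p≤q⇒p≤r⊔q q (base≤foldr-⊔ b l)

∈⇒≤foldr-⊔ : ∀ {q} b {l} → q ∈ l → q ℚ.≤ foldr ℚ._⊔_ b l
∈⇒≤foldr-⊔ b (here refl)         = ℚ.p≤p⊔q _ _
∈⇒≤foldr-⊔ b {p ∷ _} (there q∈l) = ℚ.p≤q⇒p≤r⊔q p (∈⇒≤foldr-⊔ b q∈l)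

α≤β : ∀ {k} i → suc i ≤ℕ k → α (suc i) ℚ.≤ β k
α≤β {k} zero _ = base≤foldr-⊔ (α 1) (map α [ 2 ⋯ k ])
α≤β {suc (suc k)} (suc i) (ℕ.s≤s i<k) = ∈⇒≤foldr-⊔ (α 1)
  {map α [ 2 ⋯ suc (suc k) ]} (∈-map⁺ α (∈-applyUpTo⁺ (2 ℕ.+_) i<k))

-- The summatory functions and their main terms

seq-∑ : ∀ h m t n → seq (∑ (applyUpTo h m) t) n ≡ psum (λ i → seq (t (h i)) n) m
seq-∑ h zero    t n = refl
seq-∑ h (suc m) t n = trans (cong (seq (t (h 0)) n ℚ.+_) (seq-∑ (h ∘ suc) m t n))
  (sym (psum-suc (λ i → seq (t (h i)) n) m))

seq-^ : ∀ x m n → seq (x ^ m) n ≡ seq x n ^ℚ m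
seq-^ x zero    n = refl
seq-^ x (suc m) n = cong (seq x n ℚ.*_) (seq-^ x m n)

seq-polynomial : ∀ k c t n →
  seq (polynomial k c t) n ≡ psum (λ j → seq (c j) n ℚ.* seq t n ^ℚ j) k
seq-polynomial k c t n = trans (seq-∑ (λ j → j) k (λ j → c j * t ^ j) n)
  (psum-cong (λ j → cong (seq (c j) n ℚ.*_) (seq-^ t j n)) k)

-- F_k = ∑_{i ≤ k} (-1)^(k-i) C(k,i) D_i.
seq-F : ∀ k x n → seq (F k x) n ≡ psum (λ i → coeff k i ℚ.* seq (D i x) n) (suc k)
seq-F k x n = begin
  fromℕℚ (sum (map (f k) [ 1 ⋯ N ]))   ≡⟨ cong fromℕℚ (sum-f N k) ⟩
  fromℕℚ (mixedTotal N k 0)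
    ≡⟨ binomial-inversion (λ j i → fromℕℚ (mixedTotal N j i))
         (λ j i → trans (cong fromℕℚ (mixedTotal-suc N j i))
           (fromℕℚ-+ (mixedTotal N j i) (mixedTotal N (suc j) i))) k ⟩
  psum (λ i → coeff k i ℚ.* fromℕℚ (mixedTotal N 0 i)) (suc k)
    ≡⟨ psum-cong (λ i → cong (λ m → coeff k i ℚ.* fromℕℚ m) (sum-d N i)) (suc k) ⟨
  psum (λ i → coeff k i ℚ.* seq (D i x) n) (suc k) ∎
  where
  open ≡-Reasoning
  N = ⌊ x ⌋

seq-b : ∀ a k j n → seq (b a k j) n ≡
  psum (λ r → coeff k (suc j ℕ.+ r) ℚ.* seq (a (suc j ℕ.+ r) j) n) (k ∸ j)
seq-b a k j n = seq-∑ (suc j ℕ.+_) (k ∸ j)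
  (λ i → fromℤ (-1ℤ ℤ.^ (k ∸ i) ℤ.* ℤ.+ (k C i)) * a i j) n

-- P_k^F = ∑_{i ≤ k} (-1)^(k-i) C(k,i) P_i, where P_0 is the empty sum.
seq-Pᶠ : ∀ a k t n → seq (Pᶠ a k t) n ≡
  psum (λ i → coeff k i ℚ.* seq (polynomial i (a i) t) n) (suc k)
seq-Pᶠ a k t n = begin
  seq (Pᶠ a k t) n
    ≡⟨ seq-polynomial k (b a k) t n ⟩
  psum (λ j → seq (b a k j) n ℚ.* T^ j) k
    ≡⟨ psum-cong (λ j → cong (ℚ._* T^ j) (seq-b a k j n)) k ⟩
  psum (λ j → psum (λ r → c (suc j ℕ.+ r) j) (k ∸ j) ℚ.* T^ j) k
    ≡⟨ psum-cong (λ j → psum-*ʳ (T^ j) (λ r → c (suc j ℕ.+ r) j) (k ∸ j)) k ⟨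
  psum (λ j → psum (λ r → c (suc j ℕ.+ r) j ℚ.* T^ j) (k ∸ j)) k
    ≡⟨ psum-triangle (λ i j → c i j ℚ.* T^ j) k ⟨
  psum (λ i → psum (λ j → c i j ℚ.* T^ j) i) (suc k)
    ≡⟨ psum-cong (λ i → trans
         (psum-cong (λ j → ℚ.*-assoc (coeff k i) (seq (a i j) n) (T^ j)) i)
         (psum-*ˡ (coeff k i) (λ j → seq (a i j) n ℚ.* T^ j) i)) (suc k) ⟩
  psum (λ i → coeff k i ℚ.* psum (λ j → seq (a i j) n ℚ.* T^ j) i) (suc k)
    ≡⟨ psum-cong (λ i → cong (coeff k i ℚ.*_) (seq-polynomial i (a i) t n)) (suc k) ⟨
  psum (λ i → coeff k i ℚ.* seq (polynomial i (a i) t) n) (suc k) ∎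
  where
  open ≡-Reasoning
  T^ : ℕ → ℚ
  T^ j = seq t n ^ℚ j
  c : ℕ → ℕ → ℚ
  c i j = coeff k i ℚ.* seq (a i j) n

-- The error terms

-- The error term in the divisor problem; for i = 0, where the polynomial is
-- empty, it is D_0.
remainder : (ℕ → ℕ → ℝ) → ℕ → ℝ≥1 → ℝ
remainder a i x = D i x - val x * polynomial i (a i) (log x)

-- The error term Δ_k^F.
remainderᶠ : (ℕ → ℕ → ℝ) → ℕ → ℝ≥1 → ℝ
remainderᶠ a k x = F k x - val x * Pᶠ a k (log x)

remainderᶠ≡∑ : ∀ a k x →
  seq (remainderᶠ a k x) ≗ seq (∑[ i ∈ upTo (suc k) ] (fromℚ (coeff k i) * remainder a i x))
remainderᶠ≡∑ a k x n = begin
  seq (F k x) n ℚ.- v ℚ.* seq (Pᶠ a k (log x)) n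
    ≡⟨ cong₂ (λ y z → y ℚ.- v ℚ.* z) (seq-F k x n) (seq-Pᶠ a k (log x) n) ⟩
  psum (λ i → coeff k i ℚ.* D′ i) (suc k) ℚ.- v ℚ.* psum (λ i → coeff k i ℚ.* P′ i) (suc k)
    ≡⟨ cong (λ z → psum (λ i → coeff k i ℚ.* D′ i) (suc k) ℚ.- z)
         (psum-*ˡ v (λ i → coeff k i ℚ.* P′ i) (suc k)) ⟨
  psum (λ i → coeff k i ℚ.* D′ i) (suc k) ℚ.- psum (λ i → v ℚ.* (coeff k i ℚ.* P′ i)) (suc k)
    ≡⟨ psum-minus (λ i → coeff k i ℚ.* D′ i) (λ i → v ℚ.* (coeff k i ℚ.* P′ i)) (suc k) ⟨
  psum (λ i → coeff k i ℚ.* D′ i ℚ.- v ℚ.* (coeff k i ℚ.* P′ i)) (suc k)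
    ≡⟨ psum-cong (λ i → solve 4 (λ c d v p → c :* d :- v :* (c :* p) := c :* (d :- v :* p)) refl
         (coeff k i) (D′ i) v (P′ i)) (suc k) ⟩
  psum (λ i → coeff k i ℚ.* seq (remainder a i x) n) (suc k)
    ≡⟨ seq-∑ (λ i → i) (suc k) (λ i → fromℚ (coeff k i) * remainder a i x) n ⟨
  seq (∑[ i ∈ upTo (suc k) ] (fromℚ (coeff k i) * remainder a i x)) n ∎
  where
  open ≡-Reasoning
  open +-*-Solver
  v = seq (val x) n
  D′ P′ : ℕ → ℚ
  D′ i = seq (D i x) n
  P′ i = seq (polynomial i (a i) (log x)) n

0≤1 : 0ℝ ≤ 1ℝ
0≤1 = seqwise-≤ (0 , λ _ _ → ℚ.nonNegative⁻¹ 1ℚ)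

remainder-0 : ∀ a → remainder a zero =O (λ _ → 1ℝ)
remainder-0 a = 1ℝ , 0ℝ , λ x _ → seqwise-≤ (0 , λ n _ → bound (seq (val x) n) (sum-d0≤1 ⌊ x ⌋))
  where
  bound : ∀ v {m} → m ≤ℕ 1 → ℚ.∣ fromℕℚ m ℚ.- v ℚ.* 0ℚ ∣ ℚ.≤ 1ℚ
  bound v {m} m≤1 = subst (ℚ._≤ 1ℚ)
    (sym (trans (cong ℚ.∣_∣ (solve 2 (λ m v → m :- v :* con 0ℚ := m) refl (fromℕℚ m) v))
      (ℚ.0≤p⇒∣p∣≡p (0≤fromℕℚ m))))
    (fromℕℚ-mono m≤1)
    where open +-*-Solver

remainderᶠ-=O : ∀ a k {g} → (∀ i → i ≤ℕ k → remainder a i =O g) → remainderᶠ a k =O g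
remainderᶠ-=O a k {g} bounds =
  =O-cong {remainderᶠ a k} {λ x → ∑[ i ∈ upTo (suc k) ] (fromℚ (coeff k i) * remainder a i x)} {g}
    (remainderᶠ≡∑ a k)
    (=O-∑ {g} (λ i x → fromℚ (coeff k i) * remainder a i x) {upTo (suc k)}
      (All.applyUpTo⁺₁ {P = λ i → (λ x → fromℚ (coeff k i) * remainder a i x) =O g}
        (λ i → i) (suc k) λ {i} i≤k → =O-scale (coeff k i) {remainder a i} {g} (bounds i (ℕ.≤-pred i≤k))))

remainder-=O : ∀ a → IsDivisorCoefficients a → ∀ {k} → 1 ≤ℕ k → ∀ ε → 0ℝ < ε → ∀ i → i ≤ℕ k →
  remainder a i =O (λ x → x ^ℝ (fromℚ (β k) + ε))
remainder-=O a isCoeff {k} 1≤k ε 0<ε zero _ =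
  =O-mono {remainder a zero} {λ _ → 1ℝ} {λ x → x ^ℝ (fromℚ (β k) + ε)} (λ _ → 0≤1)
    (1≤^ℝ {β k} ε (ℚ.≤-trans (0≤α 1) (α≤β {k} 0 1≤k)) 0<ε) (remainder-0 a)
remainder-=O a isCoeff {k} 1≤k ε 0<ε (suc i) i<k =
  =O-mono {remainder a (suc i)} {λ x → x ^ℝ (fromℚ (α (suc i)) + ε)} {λ x → x ^ℝ (fromℚ (β k) + ε)}
    (λ x → ≤-transitive {0ℝ} {1ℝ} {x ^ℝ (fromℚ (α (suc i)) + ε)} 0≤1
      (1≤^ℝ {α (suc i)} ε (0≤α (suc i)) 0<ε x))
    (^ℝ-mono {α (suc i)} {β k} ε (0≤α (suc i)) (α≤β {k} i i<k) 0<ε)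
    (=O-cong {remainder a (suc i)}
      {λ x → D (suc i) x - val x * polynomial (suc i) (a (suc i)) (log x)}
      {λ x → x ^ℝ (fromℚ (α (suc i)) + ε)} (λ _ _ → refl)
      (isCoeff (suc i) (ℕ.s≤s ℕ.z≤n) ε 0<ε))

theorem4p2 : (a : ℕ → ℕ → ℝ) → IsDivisorCoefficients a →
    ∀ (k : ℕ) → 1 ≤ℕ k →
    Σ[ Δᶠ ∈ (ℝ≥1 → ℝ) ]
    (∀ (x : ℝ≥1) → F k x ≃ val x * Pᶠ a k (log x) + Δᶠ x) ×
    (∀ (ε : ℝ) → 0ℝ < ε → Δᶠ =O (λ x → x ^ℝ (fromℚ (β k) + ε)))
theorem4p2 a isCoeff k 1≤k = remainderᶠ a k , decomposition ,
  λ ε 0<ε → remainderᶠ-=O a k {λ x → x ^ℝ (fromℚ (β k) + ε)} (remainder-=O a isCoeff 1≤k ε 0<ε)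
  where
  decomposition : ∀ x → F k x ≃ val x * Pᶠ a k (log x) + remainderᶠ a k x
  decomposition x = seqwise-≃ {F k x} {val x * Pᶠ a k (log x) + remainderᶠ a k x} λ n →
    solve 2 (λ y z → y := z :+ (y :- z)) refl (seq (F k x) n) (seq (val x * Pᶠ a k (log x)) n)
    where open +-*-Solver
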